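{- Let $T\in\mathcal{R}/_\sim$. Then $T$ is a maximal element of $(\mathcal{R}/_\sim,\leqslant)$ if and only if (i) $T$ is a maximal element of $\mathcal{R}_{123}$, or (ii) $T=T_1T_2\cdots$, where $T_i=\omega_i\rho_1^{a_i}\rho_2^{b_i}\rho_3$ with $\omega_i\in\mathcal{L}(\{\rho_4\})\cup\mathcal{L}(\{\rho_5\})$ and $(a_i,b_i)<(1,1)$ for every $i$.
   Context: Sequences: $\mathcal{S}$ is the set of finite multisets of nonzero integers (including the empty one, $\varepsilon$). If $n_1>\dots>n_q\geqslant 1$ are the distinct absolute values occurring in $\sigma\in\mathcal{S}$, encode $\sigma$ by the pairs $(p_1,m_1),\dots,(p_q,m_q)$, where $p_k$ (resp. $m_k$) is the number of occurrences of $n_k$ (resp. $-n_k$); no pair is $(0,0)$. $\mathcal{S}_0$ is the set of $\sigma$ with $p_1>0$ and $m_1>0$. Elementary rules $\rho_1,\dots,\rho_5:\mathcal{S}\to\mathcal{S}$ act only if $p_1>0$ and $m_1>0$ (otherwise $\rho_i(\sigma)=\sigma$): $\rho_1$ replaces $p_1$ by $1$; $\rho_2$ replaces $m_1$ by $1$; $\rho_3$ replaces $(p_1,m_1)$ by $(p_1-c,m_1-c)$, $c=\min(p_1,m_1)$; $\rho_4$ replaces $p_2$ by $0$; $\rho_5$ replaces $m_2$ by $0$ (the last two do nothing if there is no second pair). Whenever a pair $(0,0)$ results it is removed and later pairs are renumbered. Words: for a set $X$ of letters, $\mathcal{L}(X)$ is the set of finite or infinite words over $X$, including $\varepsilon$;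 $w^*$ is the infinite concatenation $www\cdots$, and an infinite word may be followed by further letters. Words are read from left to right (leftmost letter applied first). Since letters only delete terms of a finite sequence, an infinite (part of a) word acts by its eventual constant value. A computation rule is $R\in\mathcal{L}(\{\rho_1,\dots,\rho_5\})$; it is well-formed (w.f.c.r.) if $R(\sigma)\notin\mathcal{S}_0$ for all $\sigma\in\mathcal{S}$; $\mathcal{R}$ is the set of w.f.c.r.'s. For $\tau\in\mathcal{S}\setminus\mathcal{S}_0$ let $v(\tau)=0$ if $\tau=\varepsilon$, and otherwise the element of $\tau$ of greatest absolute value. $R\sim R'$ iff $v(R(\sigma))=v(R'(\sigma))$ for all $\sigma$. Words $\omega\in\mathcal{L}(\{\rho_4,\rho_5\})$ are identified when redundant blocks are absorbed ($\rho_j^*\rho_j=\rho_j^*$), and any word in which $\rho_4,\rho_5$ alternate infinitely many times is identified with $(\rho_4\rho_5)^*$. In particular $\mathcal{L}(\{\rho_j\})=\{\varepsilon,\rho_j,\rho_j^2,\dots\}\cup\{\rho_j^*\}$. Factorized irredundant form: a product $T_1T_2\cdots$ of factors $T_i=\omega_i\rho_1^{a_i}\rho_2^{b_i}\rho_3$, $\omega_i\in\mathcal{L}(\{\rho_4,\rho_5\})$, $a_i,b_i\in\{0,1\}$, with either infinitely many factors or a last factor, such that no non-last factor has $\omega_i$ of the form $\omega\rho_4^*$, $\omega\rho_5^*$ or $(\rho_4\rho_5)^*$, while a last factor has $\omega_i$ of one of these forms. Every w.f.c.r. is equivalent to one in this form; w.f.c.r.'s are identified with elements of $\mathcal{R}/_\sim$,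 always written in factorized irredundant form (so the product $T_1T_2\cdots$ may be finite or infinite). Order: $R\leqslant R'$ iff for every $\sigma$ the terms of $\sigma$ deleted by $R$ include those deleted by $R'$, i.e. $R(\sigma)$ is a sub-multiset of $R'(\sigma)$. $\mathcal{R}_{123}$ is the subposet of rules with all $\omega_i=\varepsilon$ (infinite products of factors $\rho_1^{a}\rho_2^{b}\rho_3$). $(a_i,b_i)<(1,1)$ means $(a_i,b_i)\in\{(0,0),(0,1),(1,0)\}$. -}

module Defs where

open import Data.Bool using (Bool; true; false; if_then_else_)
open import Data.Empty using (⊥)
open import Data.Integer as ℤ using (ℤ; +_; -_)
open import Data.List using (List; []; _∷_; foldr)
open import Data.List.Relation.Unary.All using (All; []; _∷_)
open import Data.List.Relation.Unary.AllPairs using (AllPairs; []; _∷_)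
open import Data.List.Relation.Unary.Linked using (Linked; [])
open import Data.Nat using (ℕ; zero; suc; _+_; _∸_; _⊓_; _≤_; _>_; z≤n; s≤s)
open import Data.Product using (∃; _×_; _,_; proj₁; proj₂)
open import Data.Unit using (⊤)
open import Function using (_on_)
open import Level using (0ℓ)
open import Relation.Binary using (Rel)
open import Relation.Binary.Construct.Composition using () renaming (_;_ to _⨾_)
open import Relation.Binary.PropositionalEquality using (_≡_; _≢_)
open import Relation.Nullary using (¬_; does)

------------------------------------------------------------------------
-- Sequences

-- ⟨ n , p , m ⟩ stands for p occurrences of n and m occurrences of - n.
record Term : Set where
  constructor ⟨_,_,_⟩
  field
    abs pos neg : ℕ

open Term public

NonzeroTerm : Term → Set
NonzeroTerm t = 1 ≤ abs t × 1 ≤ pos t + neg t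

-- Finite multisets of nonzero integers, listed by decreasing absolute
-- value.  Every multiset has exactly one such listing and the proofs are
-- irrelevant, so _≡_ on 𝒮 is equality of multisets.
record 𝒮 : Set where
  constructor mk𝒮
  field
    terms       : List Term
    .nonzero    : All NonzeroTerm terms
    .decreasing : AllPairs (_>_ on abs) terms

open 𝒮 public

countTerms : ℤ → List Term → ℕ
countTerms z []                  = 0
countTerms z (⟨ n , p , m ⟩ ∷ ts) =
  (if does (z ℤ.≟ + n) then p else 0) +
  (if does (z ℤ.≟ - (+ n)) then m else 0) +
  countTerms z ts

count : ℤ → 𝒮 → ℕ
count z σ = countTerms z (terms σ)

infix 4 _⊑_
_⊑_ : Rel 𝒮 0ℓ
σ ⊑ τ = ∀ z → count z σ ≤ count z τ

𝒮₀ : 𝒮 → Set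
𝒮₀ σ with terms σ
... | []                = ⊥
... | ⟨ _ , p , m ⟩ ∷ _ = 1 ≤ p × 1 ≤ m

-- Only meaningful outside 𝒮₀, where the first pair is (p , 0) or (0 , m).
v : 𝒮 → ℤ
v σ with terms σ
... | []                     = + 0
... | ⟨ n , suc _ , _ ⟩ ∷ _ = + n
... | ⟨ n , zero  , _ ⟩ ∷ _ = - (+ n)

------------------------------------------------------------------------
-- Elementary rules

data Letter : Set where
  ρ₁ ρ₂ ρ₃ ρ₄ ρ₅ : Letter

infixr 5 _∷₀_
_∷₀_ : Term → List Term → List Term
⟨ n , zero , zero ⟩ ∷₀ ts = ts
t                   ∷₀ ts = t ∷ ts

-- The rules on sequences whose first pair has both entries positive.
active : Letter → Term → List Term → List Term
active ρ₁ ⟨ n , p , m ⟩ ts = ⟨ n , 1 , m ⟩ ∷ ts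
active ρ₂ ⟨ n , p , m ⟩ ts = ⟨ n , p , 1 ⟩ ∷ ts
active ρ₃ ⟨ n , p , m ⟩ ts = ⟨ n , p ∸ (p ⊓ m) , m ∸ (p ⊓ m) ⟩ ∷₀ ts
active ρ₄ t []                    = t ∷ []
active ρ₄ t (⟨ n , p , m ⟩ ∷ ts) = t ∷ ⟨ n , 0 , m ⟩ ∷₀ ts
active ρ₅ t []                    = t ∷ []
active ρ₅ t (⟨ n , p , m ⟩ ∷ ts) = t ∷ ⟨ n , p , 0 ⟩ ∷₀ ts

actTerms : Letter → List Term → List Term
actTerms ℓ (⟨ n , suc p , suc m ⟩ ∷ ts) = active ℓ ⟨ n , suc p , suc m ⟩ ts
actTerms ℓ ts                           = ts

private
  ∷₀-nonzero : ∀ {n p m ts} → 1 ≤ n → All NonzeroTerm ts →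
               All NonzeroTerm (⟨ n , p , m ⟩ ∷₀ ts)
  ∷₀-nonzero {p = zero}  {zero}  _   nz = nz
  ∷₀-nonzero {p = zero}  {suc _} 1≤n nz = (1≤n , s≤s z≤n) ∷ nz
  ∷₀-nonzero {p = suc _} {_}     1≤n nz = (1≤n , s≤s z≤n) ∷ nz

  ∷₀-all : ∀ {P : Term → Set} {n p m ts} → P ⟨ n , p , m ⟩ → All P ts →
           All P (⟨ n , p , m ⟩ ∷₀ ts)
  ∷₀-all {p = zero}  {zero}  _  Pts = Pts
  ∷₀-all {p = zero}  {suc _} Pt Pts = Pt ∷ Pts
  ∷₀-all {p = suc _} {_}     Pt Pts = Pt ∷ Pts

  ∷₀-decreasing : ∀ {n p m ts} → All (λ t → n > abs t) ts →
                  AllPairs (_>_ on abs) ts →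
                  AllPairs (_>_ on abs) (⟨ n , p , m ⟩ ∷₀ ts)
  ∷₀-decreasing {p = zero}  {zero}  _  ds = ds
  ∷₀-decreasing {p = zero}  {suc _} d  ds = d ∷ ds
  ∷₀-decreasing {p = suc _} {_}     d  ds = d ∷ ds

actTerms-nonzero : ∀ ℓ ts → All NonzeroTerm ts →
                   All NonzeroTerm (actTerms ℓ ts)
actTerms-nonzero ℓ [] nz = nz
actTerms-nonzero ℓ (⟨ _ , zero , _ ⟩ ∷ _) nz = nz
actTerms-nonzero ℓ (⟨ _ , suc _ , zero ⟩ ∷ _) nz = nz
actTerms-nonzero ρ₁ (⟨ _ , suc _ , suc _ ⟩ ∷ _) ((1≤n , _) ∷ nz) =
  (1≤n , s≤s z≤n) ∷ nz
actTerms-nonzero ρ₂ (⟨ _ , suc _ , suc _ ⟩ ∷ _) ((1≤n , _) ∷ nz) =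
  (1≤n , s≤s z≤n) ∷ nz
actTerms-nonzero ρ₃ (⟨ _ , suc _ , suc _ ⟩ ∷ _) ((1≤n , _) ∷ nz) =
  ∷₀-nonzero 1≤n nz
actTerms-nonzero ρ₄ (⟨ _ , suc _ , suc _ ⟩ ∷ []) nz = nz
actTerms-nonzero ρ₄ (⟨ _ , suc _ , suc _ ⟩ ∷ _ ∷ _) (t ∷ (1≤n , _) ∷ nz) =
  t ∷ ∷₀-nonzero 1≤n nz
actTerms-nonzero ρ₅ (⟨ _ , suc _ , suc _ ⟩ ∷ []) nz = nz
actTerms-nonzero ρ₅ (⟨ _ , suc _ , suc _ ⟩ ∷ _ ∷ _) (t ∷ (1≤n , _) ∷ nz) =
  t ∷ ∷₀-nonzero 1≤n nz

actTerms-decreasing : ∀ ℓ ts → AllPairs (_>_ on abs) ts →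
                      AllPairs (_>_ on abs) (actTerms ℓ ts)
actTerms-decreasing ℓ [] ds = ds
actTerms-decreasing ℓ (⟨ _ , zero , _ ⟩ ∷ _) ds = ds
actTerms-decreasing ℓ (⟨ _ , suc _ , zero ⟩ ∷ _) ds = ds
actTerms-decreasing ρ₁ (⟨ _ , suc _ , suc _ ⟩ ∷ _) (d ∷ ds) = d ∷ ds
actTerms-decreasing ρ₂ (⟨ _ , suc _ , suc _ ⟩ ∷ _) (d ∷ ds) = d ∷ ds
actTerms-decreasing ρ₃ (⟨ _ , suc _ , suc _ ⟩ ∷ _) (d ∷ ds) =
  ∷₀-decreasing d ds
actTerms-decreasing ρ₄ (⟨ _ , suc _ , suc _ ⟩ ∷ []) ds = ds
actTerms-decreasing ρ₄ (⟨ _ , suc _ , suc _ ⟩ ∷ _ ∷ _) ((n> ∷ d) ∷ d′ ∷ ds) =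
  ∷₀-all n> d ∷ ∷₀-decreasing d′ ds
actTerms-decreasing ρ₅ (⟨ _ , suc _ , suc _ ⟩ ∷ []) ds = ds
actTerms-decreasing ρ₅ (⟨ _ , suc _ , suc _ ⟩ ∷ _ ∷ _) ((n> ∷ d) ∷ d′ ∷ ds) =
  ∷₀-all n> d ∷ ∷₀-decreasing d′ ds

act : Letter → 𝒮 → 𝒮
act ℓ (mk𝒮 ts nz ds) =
  mk𝒮 (actTerms ℓ ts) (actTerms-nonzero ℓ ts nz) (actTerms-decreasing ℓ ts ds)

------------------------------------------------------------------------
-- Words and their action

-- ∞ w is the infinite concatenation w 0 · w 1 · w 2 ⋯, itself a word that
-- further letters may follow.
infixr 6 _·_
data Word : Set where
  ε   : Word
  [_] : Letter → Word
  _·_ : Word → Word → Word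
  ∞   : (ℕ → Word) → Word

infix 8 _*
_* : Word → Word
w * = ∞ (λ _ → w)

iterate : (ℕ → Rel 𝒮 0ℓ) → ℕ → Rel 𝒮 0ℓ
iterate r zero    = _≡_
iterate r (suc n) = iterate r n ⨾ r n

-- τ is the eventual constant value of s 0, s 1, … at σ, each s n being the
-- graph of a function.  That later values agree with τ is phrased without
-- asserting their existence, which for nested infinite words is only
-- classically available.
EventualValue : (ℕ → Rel 𝒮 0ℓ) → Rel 𝒮 0ℓ
EventualValue s σ τ =
  ∃ λ N → s N σ τ × (∀ n → N ≤ n → ∀ τ′ → s n σ τ′ → τ′ ≡ τ)

-- ⟦ w ⟧ σ τ: the word w, read from left to right, sends σ to τ.  This is the
-- graph of a function; it is a relation because the eventual value of an
-- arbitrary infinite word is not computable.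
⟦_⟧ : Word → Rel 𝒮 0ℓ
⟦ ε ⟧     = _≡_
⟦ [ ℓ ] ⟧ σ τ = act ℓ σ ≡ τ
⟦ w · w′ ⟧ = ⟦ w ⟧ ⨾ ⟦ w′ ⟧
⟦ ∞ w ⟧   = EventualValue (iterate (λ n → ⟦ w n ⟧))

WellFormed : Word → Set
WellFormed R = ∀ σ τ → ⟦ R ⟧ σ τ → ¬ 𝒮₀ τ

infix 4 _∼_ _≼_

_∼_ : Rel Word 0ℓ
R ∼ R′ = ∀ σ τ τ′ → ⟦ R ⟧ σ τ → ⟦ R′ ⟧ σ τ′ → v τ ≡ v τ′

_≼_ : Rel Word 0ℓ
R ≼ R′ = ∀ σ τ τ′ → ⟦ R ⟧ σ τ → ⟦ R′ ⟧ σ τ′ → τ ⊑ τ′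

------------------------------------------------------------------------
-- ℒ({ρ₄,ρ₅}) up to the identifications

data Letter₄₅ : Set where
  four five : Letter₄₅

letter : Letter₄₅ → Letter
letter four = ρ₄
letter five = ρ₅

-- 1+ k is the exponent k + 1, and ∗ that of an infinite repetition.
data Exponent : Set where
  1+_ : ℕ → Exponent
  ∗   : Exponent

Block : Set
Block = Letter₄₅ × Exponent

-- Absorbing redundant letters leaves either finitely many maximal blocks
-- ρⱼᵏ or ρⱼ*, with neighbouring blocks on different letters, or (ρ₄ρ₅)*.
data ℒ₄₅ : Set where
  blocks  : (bs : List Block) → Linked (_≢_ on proj₁) bs → ℒ₄₅
  ⟨ρ₄ρ₅⟩* : ℒ₄₅

ε₄₅ : ℒ₄₅
ε₄₅ = blocks [] []

power : Word → ℕ → Word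
power w zero    = ε
power w (suc n) = w · power w n

blockWord : Block → Word
blockWord (j , 1+ k) = power [ letter j ] (suc k)
blockWord (j , ∗)    = [ letter j ] *

word₄₅ : ℒ₄₅ → Word
word₄₅ (blocks bs _) = foldr (λ b w → blockWord b · w) ε bs
word₄₅ ⟨ρ₄ρ₅⟩*       = ([ ρ₄ ] · [ ρ₅ ]) *

LastBlockInfinite : List Block → Set
LastBlockInfinite []             = ⊥
LastBlockInfinite ((_ , e) ∷ []) = e ≡ ∗
LastBlockInfinite (_ ∷ b ∷ bs)   = LastBlockInfinite (b ∷ bs)

-- ω has the form ω′ρ₄*, ω′ρ₅* or (ρ₄ρ₅)*.
Final : ℒ₄₅ → Set
Final (blocks bs _) = LastBlockInfinite bs
Final ⟨ρ₄ρ₅⟩*       = ⊤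

infix 4 _∈ℒ_
_∈ℒ_ : ℒ₄₅ → Letter₄₅ → Set
blocks bs _ ∈ℒ j = All (λ b → proj₁ b ≡ j) bs
⟨ρ₄ρ₅⟩*     ∈ℒ j = ⊥

------------------------------------------------------------------------
-- Factorized irredundant forms

-- true and false are the exponents 1 and 0.
record Factor : Set where
  constructor factor
  field
    ω   : ℒ₄₅
    a b : Bool

open Factor public

infix 8 _^_
_^_ : Letter → Bool → Word
ℓ ^ true  = [ ℓ ]
ℓ ^ false = ε

factorWord : Factor → Word
factorWord T = word₄₅ (ω T) · ρ₁ ^ a T · ρ₂ ^ b T · [ ρ₃ ]

data Form : Set where
  infinite : (Ts : ℕ → Factor) → (∀ i → ¬ Final (ω (Ts i))) → Form
  finite   : (Ts : List Factor) → All (λ T → ¬ Final (ω T)) Ts →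
             (last : Factor) → Final (ω last) → Form

word : Form → Word
word (infinite Ts _)      = ∞ (λ i → factorWord (Ts i))
word (finite Ts _ last _) = foldr (λ T w → factorWord T · w) (factorWord last) Ts

EveryFactor : (Factor → Set) → Form → Set
EveryFactor P (infinite Ts _)      = ∀ i → P (Ts i)
EveryFactor P (finite Ts _ last _) = All P Ts × P last

-- A form with every ωᵢ empty is automatically an infinite product, since
-- the last factor of a finite one has a nonempty ω.
R₁₂₃ : Form → Set
R₁₂₃ = EveryFactor (λ T → ω T ≡ ε₄₅)

------------------------------------------------------------------------
-- Maximal elements; equality in the quotient is _∼_

-- The class of T is a maximal element of the set of all well-formed
-- computation rules modulo _∼_.
MaximalInR : Form → Set
MaximalInR T =
  WellFormed (word T) × (∀ R → WellFormed R → word T ≼ R → R ∼ word T)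

MaximalInR₁₂₃ : Form → Set
MaximalInR₁₂₃ T =
  R₁₂₃ T × (∀ R → R₁₂₃ R → word T ≼ word R → word R ∼ word T)

-- Necessity.  Every violating factor can be replaced so that fewer terms are
-- deleted: (a , b) = (1 , 1) by (0 , 0), and an ω that changes letter, say
-- ω = A ρⱼ ρₗ W with {j , l} = {4 , 5}, by A ρ₁ᵃρ₂ᵇρ₃ W.  A change from ρⱼ to ρₗ
-- deletes the next pair whenever A has left it with both entries positive, and
-- then nothing is lost by letting it become the first pair.  The first
-- replacement stays in 𝓡₁₂₃, so condition (i) is a special case of (ii).
--
-- Sufficiency.  If T satisfies (ii) and T ≼ R, then R = T as functions.  On
-- finitely many sequences R acts as a finite word L = U ρ₃ V with no ρ₃ in U.
-- Sequences such as (2 , 1), (1 , 2), (2 , 2) force U to contain ρ₁ and ρ₂ as T₁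
-- does, and sequences (1 , 1) followed by pairs (1 , 0), (0 , 1), (1 , 1) force its
-- letters ρ₄, ρ₅ to act as ω₁.  Then V is above T₂T₃⋯, and one recurses.
module Submission where

open import Defs
open import Data.Bool using (Bool; true; false; if_then_else_)
open import Data.Empty using (⊥; ⊥-elim)
open import Data.Integer as ℤ using (+_; -_)
open import Data.List using (List; []; _∷_; _++_; map; foldr; length; replicate; applyUpTo)
open import Data.List.Relation.Unary.All as All using (All; []; _∷_)
open import Data.List.Relation.Unary.All.Properties using (++⁺; ++⁻ˡ; ++⁻ʳ; applyUpTo⁻; map⁻)
open import Data.List.Relation.Unary.AllPairs using (AllPairs; []; _∷_)
open import Data.List.Relation.Unary.Linked using (Linked; _∷_)
open import Data.Nat using (ℕ; zero; suc; _+_; _∸_; _⊓_; _⊔_; _≤_; _<_; _>_; z≤n; s≤s; s≤s⁻¹)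
open import Data.Nat.Properties
open import Data.Product using (∃; ∃₂; _×_; _,_; proj₁; proj₂)
open import Data.Sum using (_⊎_; inj₁; inj₂)
open import Data.Unit using (⊤; tt)
open import Function using (_∘_; _on_; id)
open import Function.Bundles using (_⇔_; mk⇔)
open import Level using (0ℓ)
open import Relation.Binary using (Rel)
open import Relation.Binary.Construct.Composition using () renaming (_;_ to _⨾_)
open import Relation.Binary.PropositionalEquality
  using (_≡_; _≢_; refl; sym; trans; cong; subst; subst₂)
open import Relation.Nullary using (¬_; Dec; yes; no; does; contradiction)
open import Relation.Nullary.Decidable using (decidable-stable; ¬¬-excluded-middle)

-- Sequences

-- Deleting fewer terms at one stage need not mean deleting fewer in the end, since the larger
-- sequence may still be active and lose more later. Improvements are therefore measured by `_⊴_`: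
-- equal, or larger and already stopped. This passes through finite and infinite products, so every
-- violating factor is replaced in a single competitor. The equivalence that maximality then
-- provides sees only `v`; each replacement thus carries a sequence on which the old factor leaves
-- nothing and the new one something stopped, a defect that no continuation repairs. Factors are
-- recovered from the left, a good one being cancelled because a factor that is not final is
-- surjective. Conversely, the competitor `R` is an arbitrary, possibly nested infinite word, whose
-- values exist only up to double negation. The tests for a given `σ` are chosen from `T` and `σ`
-- alone, before `R` is looked at; compactness then replaces `R` by one finite word on all of them
-- together.

𝒮-≡ : ∀ {σ τ} → terms σ ≡ terms τ → σ ≡ τ
𝒮-≡ {mk𝒮 _ _ _} {mk𝒮 _ _ _} refl = refl

Active : List Term → Set
Active (⟨ _ , suc _ , suc _ ⟩ ∷ _) = ⊤
Active _                           = ⊥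

𝒮₀⇒Active : ∀ σ → 𝒮₀ σ → Active (terms σ)
𝒮₀⇒Active (mk𝒮 (⟨ _ , suc _ , suc _ ⟩ ∷ _) _ _) _ = tt

Active⇒𝒮₀ : ∀ σ → Active (terms σ) → 𝒮₀ σ
Active⇒𝒮₀ (mk𝒮 (⟨ _ , suc _ , suc _ ⟩ ∷ _) _ _) _ = s≤s z≤n , s≤s z≤n

data Activity : List Term → Set where
  isActive   : ∀ n p m ts → Activity (⟨ n , suc p , suc m ⟩ ∷ ts)
  isInactive : ∀ {ts} → ¬ Active ts → Activity ts

activity : ∀ ts → Activity ts
activity []                              = isInactive λ ()
activity (⟨ _ , zero  , _     ⟩ ∷ _)     = isInactive λ ()
activity (⟨ _ , suc _ , zero  ⟩ ∷ _)     = isInactive λ ()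
activity (⟨ n , suc p , suc m ⟩ ∷ ts)    = isActive n p m ts

infix 4 _⊆_
-- An inductive stand-in for `_⊑_`: it implies the inequality of all counts and, unlike that,
-- supports induction along the list.
data _⊆_ : Rel (List Term) 0ℓ where
  []   : [] ⊆ []
  skip : ∀ {t us ts} → us ⊆ ts → us ⊆ t ∷ ts
  keep : ∀ {n p q m k us ts} → p ≤ q → m ≤ k → us ⊆ ts →
         ⟨ n , p , m ⟩ ∷ us ⊆ ⟨ n , q , k ⟩ ∷ ts

⊆-refl : ∀ {ts} → ts ⊆ ts
⊆-refl {[]}    = []
⊆-refl {_ ∷ _} = keep ≤-refl ≤-refl ⊆-refl

⊆-trans : ∀ {us ts xs} → us ⊆ ts → ts ⊆ xs → us ⊆ xs
⊆-trans p            []              = p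
⊆-trans p            (skip q)        = skip (⊆-trans p q)
⊆-trans (skip p)     (keep _ _ q)    = skip (⊆-trans p q)
⊆-trans (keep a b p) (keep a′ b′ q)  = keep (≤-trans a a′) (≤-trans b b′) (⊆-trans p q)

∷₀-⊆ : ∀ {n p q m k us ts} → p ≤ q → m ≤ k → us ⊆ ts →
       ⟨ n , p , m ⟩ ∷₀ us ⊆ ⟨ n , q , k ⟩ ∷ ts
∷₀-⊆ {p = zero}  {m = zero}  _ _ s = skip s
∷₀-⊆ {p = zero}  {m = suc _} a b s = keep a b s
∷₀-⊆ {p = suc _} {m = _}     a b s = keep a b s

actTerms-⊆ : ∀ ℓ ts → actTerms ℓ ts ⊆ ts
actTerms-⊆ ℓ  []                              = []
actTerms-⊆ ℓ  (⟨ _ , zero  , _    ⟩ ∷ _)      = ⊆-refl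
actTerms-⊆ ℓ  (⟨ _ , suc _ , zero ⟩ ∷ _)      = ⊆-refl
actTerms-⊆ ρ₁ (⟨ _ , suc _ , suc _ ⟩ ∷ _)     = keep (s≤s z≤n) ≤-refl ⊆-refl
actTerms-⊆ ρ₂ (⟨ _ , suc _ , suc _ ⟩ ∷ _)     = keep ≤-refl (s≤s z≤n) ⊆-refl
actTerms-⊆ ρ₃ (⟨ _ , suc p , suc m ⟩ ∷ _)     =
  ∷₀-⊆ (m∸n≤m (suc p) (suc p ⊓ suc m)) (m∸n≤m (suc m) (suc p ⊓ suc m)) ⊆-refl
actTerms-⊆ ρ₄ (⟨ _ , suc _ , suc _ ⟩ ∷ [])    = ⊆-refl
actTerms-⊆ ρ₄ (⟨ _ , suc _ , suc _ ⟩ ∷ _ ∷ _) =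
  keep ≤-refl ≤-refl (∷₀-⊆ z≤n ≤-refl ⊆-refl)
actTerms-⊆ ρ₅ (⟨ _ , suc _ , suc _ ⟩ ∷ [])    = ⊆-refl
actTerms-⊆ ρ₅ (⟨ _ , suc _ , suc _ ⟩ ∷ _ ∷ _) =
  keep ≤-refl ≤-refl (∷₀-⊆ ≤-refl z≤n ⊆-refl)

-- The summand suc makes size strictly monotone even for pairs (0 , 0).
size : List Term → ℕ
size []                   = 0
size (⟨ _ , p , m ⟩ ∷ ts) = suc (p + m) + size ts

size-mono : ∀ {us ts} → us ⊆ ts → size us ≤ size ts
size-mono []                        = z≤n
size-mono (skip {⟨ _ , p , m ⟩} s)  = ≤-trans (size-mono s) (m≤n+m _ (suc (p + m)))
size-mono (keep a b s)              = +-mono-≤ (s≤s (+-mono-≤ a b)) (size-mono s)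

size-equal : ∀ {us ts} → us ⊆ ts → size ts ≤ size us → us ≡ ts
size-equal [] _ = refl
size-equal (skip {⟨ _ , p , m ⟩} s) le =
  contradiction (≤-trans le (size-mono s)) (<⇒≱ (s≤s (m≤n+m _ (p + m))))
size-equal {⟨ n , p , m ⟩ ∷ us} {⟨ _ , q , k ⟩ ∷ ts} (keep a b s) le =
  lemma (≤-antisym a q≤p) (≤-antisym b k≤m) (size-equal s ts≤us)
  where
  S = size us
  lemma : p ≡ q → m ≡ k → us ≡ ts → ⟨ n , p , m ⟩ ∷ us ≡ ⟨ n , q , k ⟩ ∷ ts
  lemma refl refl refl = refl
  ts≤us : size ts ≤ size us
  ts≤us = +-cancelˡ-≤ (suc (p + m)) _ _
    (≤-trans (+-monoˡ-≤ (size ts) (s≤s (+-mono-≤ a b))) le)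
  q+k≤p+m : q + k ≤ p + m
  q+k≤p+m = s≤s⁻¹ (+-cancelʳ-≤ S _ _
    (≤-trans (+-monoʳ-≤ (suc (q + k)) (size-mono s)) le))
  q≤p : q ≤ p
  q≤p = +-cancelʳ-≤ k _ _ (≤-trans q+k≤p+m (+-monoʳ-≤ p b))
  k≤m : k ≤ m
  k≤m = +-cancelˡ-≤ q _ _ (≤-trans q+k≤p+m (+-monoˡ-≤ m a))

if-mono : ∀ c {p q} → p ≤ q → (if c then p else 0) ≤ (if c then q else 0)
if-mono true  p≤q = p≤q
if-mono false _   = z≤n

countTerms-mono : ∀ z {us ts} → us ⊆ ts → countTerms z us ≤ countTerms z ts
countTerms-mono z []       = z≤n
countTerms-mono z (skip s) = ≤-trans (countTerms-mono z s) (m≤n+m _ _)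
countTerms-mono z (keep {n} a b s) =
  +-mono-≤ (+-mono-≤ (if-mono (does (z ℤ.≟ + n)) a) (if-mono (does (z ℤ.≟ - (+ n))) b))
           (countTerms-mono z s)

-- Finite words

run : List Letter → 𝒮 → 𝒮
run []      σ = σ
run (ℓ ∷ L) σ = run L (act ℓ σ)

runₗ : List Letter → List Term → List Term
runₗ []      ts = ts
runₗ (ℓ ∷ L) ts = runₗ L (actTerms ℓ ts)

terms-run : ∀ L σ → terms (run L σ) ≡ runₗ L (terms σ)
terms-run []      σ = refl
terms-run (ℓ ∷ L) σ = terms-run L (act ℓ σ)

run-++ : ∀ L M σ → run (L ++ M) σ ≡ run M (run L σ)
run-++ []      M σ = refl
run-++ (ℓ ∷ L) M σ = run-++ L M (act ℓ σ)

runₗ-++ : ∀ L M ts → runₗ (L ++ M) ts ≡ runₗ M (runₗ L ts)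
runₗ-++ []      M ts = refl
runₗ-++ (ℓ ∷ L) M ts = runₗ-++ L M (actTerms ℓ ts)

actTerms-inactive : ∀ ℓ {ts} → ¬ Active ts → actTerms ℓ ts ≡ ts
actTerms-inactive ℓ {[]}                          _  = refl
actTerms-inactive ℓ {⟨ _ , zero  , _     ⟩ ∷ _}   _  = refl
actTerms-inactive ℓ {⟨ _ , suc _ , zero  ⟩ ∷ _}   _  = refl
actTerms-inactive ℓ {⟨ _ , suc _ , suc _ ⟩ ∷ _}   ¬a = contradiction tt ¬a

act-inactive : ∀ ℓ {σ} → ¬ Active (terms σ) → act ℓ σ ≡ σ
act-inactive ℓ ¬a = 𝒮-≡ (actTerms-inactive ℓ ¬a)

runₗ-inactive : ∀ L {ts} → ¬ Active ts → runₗ L ts ≡ ts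
runₗ-inactive []      _  = refl
runₗ-inactive (ℓ ∷ L) ¬a = trans (cong (runₗ L) (actTerms-inactive ℓ ¬a)) (runₗ-inactive L ¬a)

runₗ-⊆ : ∀ L ts → runₗ L ts ⊆ ts
runₗ-⊆ []      ts = ⊆-refl
runₗ-⊆ (ℓ ∷ L) ts = ⊆-trans (runₗ-⊆ L _) (actTerms-⊆ ℓ ts)

run-⊆ : ∀ L σ → terms (run L σ) ⊆ terms σ
run-⊆ L σ = subst (_⊆ terms σ) (sym (terms-run L σ)) (runₗ-⊆ L (terms σ))

-- Words as graphs of functions

Functional : Rel 𝒮 0ℓ → Set
Functional r = ∀ {σ τ τ′} → r σ τ → r σ τ′ → τ ≡ τ′

iterate-functional : ∀ r → (∀ n → Functional (r n)) → ∀ n → Functional (iterate r n)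
iterate-functional r f zero    refl        refl        = refl
iterate-functional r f (suc n) (_ , i , s) (_ , i′ , s′)
  with refl ← iterate-functional r f n i i′ = f n s s′

eventual-functional : ∀ s → Functional (EventualValue s)
eventual-functional s (N , i , e) (N′ , i′ , e′) with ≤-total N N′
... | inj₁ le = sym (e N′ le _ i′)
... | inj₂ le = e′ N le _ i

functional : ∀ w → Functional ⟦ w ⟧
functional ε       refl refl = refl
functional [ ℓ ]   refl refl = refl
functional (w · w′) (_ , s , t) (_ , s′ , t′) with refl ← functional w s s′ = functional w′ t t′
functional (∞ w)   = eventual-functional (iterate (λ n → ⟦ w n ⟧))

infixl 6 _≫_
-- With `i + n` rather than `n + i`, the prefix of length `suc m + n` unfolds to the word at index
-- `m + n`, so joining and splitting prefixes compute by recursion on `m`.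
_≫_ : (ℕ → Word) → ℕ → ℕ → Word
(w ≫ n) i = w (i + n)

prefix : (ℕ → Word) → ℕ → Rel 𝒮 0ℓ
prefix w = iterate (λ n → ⟦ w n ⟧)

prefix-functional : ∀ w n → Functional (prefix w n)
prefix-functional w = iterate-functional _ (λ n → functional (w n))

prefix-join : ∀ w n m {σ x τ} → prefix w n σ x → prefix (w ≫ n) m x τ → prefix w (m + n) σ τ
prefix-join w n zero    i refl        = i
prefix-join w n (suc m) i (y , j , s) = y , prefix-join w n m i j , s

prefix-split : ∀ w n m {σ τ} → prefix w (m + n) σ τ →
               ∃ λ x → prefix w n σ x × prefix (w ≫ n) m x τ
prefix-split w n zero    i           = _ , i , refl
prefix-split w n (suc m) (y , i , s) =
  let x , j , k = prefix-split w n m i in x , j , y , k , s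

∞-join : ∀ w n {σ x τ} → prefix w n σ x → ⟦ ∞ (w ≫ n) ⟧ x τ → ⟦ ∞ w ⟧ σ τ
∞-join w n {σ} {x} {τ} i (N , j , e) = N + n , prefix-join w n N i j , later
  where
  later : ∀ n′ → N + n ≤ n′ → ∀ τ′ → prefix w n′ σ τ′ → τ′ ≡ τ
  later n′ le τ′ i′ with prefix-split w n (n′ ∸ n)
    (subst (λ k → prefix w k σ τ′) (sym (m∸n+n≡m (≤-trans (m≤n+m n N) le))) i′)
  ... | x′ , i″ , j′ with refl ← prefix-functional w n i i″ =
    e (n′ ∸ n) (m+n≤o⇒m≤o∸n N le) τ′ j′

∞-cons : ∀ w {σ x τ} → ⟦ w 0 ⟧ σ x → ⟦ ∞ (w ≫ 1) ⟧ x τ → ⟦ ∞ w ⟧ σ τ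
∞-cons w s = ∞-join w 1 (_ , refl , s)

∞-uncons : ∀ w {σ x τ} → ⟦ ∞ w ⟧ σ τ → ⟦ w 0 ⟧ σ x → ⟦ ∞ (w ≫ 1) ⟧ x τ
-- The index 0 cannot be lowered. But if the value is constant from the start, then `w 0` already
-- fixes `σ`, which is what `e 1` says.
∞-uncons w {σ} {x} {τ} (zero , refl , e) s = 0 , e 1 z≤n x (σ , refl , s) , λ n _ τ′ i →
  e (n + 1) z≤n τ′ (prefix-join w 1 n (σ , refl , s) i)
∞-uncons w {σ} {x} {τ} (suc N , i , e) s
  with prefix-split w 1 N (subst (λ k → prefix w k σ τ) (+-comm 1 N) i)
... | _ , (_ , refl , s′) , j with refl ← functional (w 0) s s′ =
  N , j , λ n le τ′ i′ → e (n + 1) (subst (_≤ n + 1) (+-comm N 1) (+-monoˡ-≤ 1 le)) τ′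
    (prefix-join w 1 n (σ , refl , s) i′)

AllLetters : (Letter → Set) → Word → Set
AllLetters Q ε        = ⊤
AllLetters Q [ ℓ ]    = Q ℓ
AllLetters Q (w · w′) = AllLetters Q w × AllLetters Q w′
AllLetters Q (∞ w)    = ∀ n → AllLetters Q (w n)

allLetters : ∀ w → AllLetters (λ _ → ⊤) w
allLetters ε        = tt
allLetters [ ℓ ]    = tt
allLetters (w · w′) = allLetters w , allLetters w′
allLetters (∞ w)    = λ n → allLetters (w n)

mutual
  word-⊆ : ∀ w {σ τ} → ⟦ w ⟧ σ τ → terms τ ⊆ terms σ
  word-⊆ ε        refl        = ⊆-refl
  word-⊆ [ ℓ ]    refl        = actTerms-⊆ ℓ _
  word-⊆ (w · w′) (_ , s , t) = ⊆-trans (word-⊆ w′ t) (word-⊆ w s)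
  word-⊆ (∞ w)    (N , i , _) = prefix-⊆ w N i

  prefix-⊆ : ∀ w n {σ τ} → prefix w n σ τ → terms τ ⊆ terms σ
  prefix-⊆ w zero    refl        = ⊆-refl
  prefix-⊆ w (suc n) (_ , i , s) = ⊆-trans (word-⊆ (w n) s) (prefix-⊆ w n i)

mutual
  fixed : ∀ {Q} w {σ} → (∀ {ℓ} → Q ℓ → act ℓ σ ≡ σ) → AllLetters Q w → ⟦ w ⟧ σ σ
  fixed ε        f q        = refl
  fixed [ ℓ ]    f q        = f q
  fixed (w · w′) f (q , q′) = _ , fixed w f q , fixed w′ f q′
  fixed (∞ w)    f q        =
    0 , refl , λ n _ _ i → prefix-functional w n i (prefix-fixed w n f q)

  prefix-fixed : ∀ {Q} w n {σ} → (∀ {ℓ} → Q ℓ → act ℓ σ ≡ σ) →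
                 (∀ n → AllLetters Q (w n)) → prefix w n σ σ
  prefix-fixed w zero    f q = refl
  prefix-fixed w (suc n) f q = _ , prefix-fixed w n f q , fixed (w n) f (q n)

fixed-inactive : ∀ w {σ} → ¬ Active (terms σ) → ⟦ w ⟧ σ σ
fixed-inactive w ¬a = fixed w (λ {ℓ} _ → act-inactive ℓ ¬a) (allLetters w)

-- Compactness: on finitely many sequences every word acts as a finite one

Agrees : Rel 𝒮 0ℓ → List Letter → 𝒮 → Set
Agrees r L σ = r σ (run L σ)

-- One `L` serves all of `σs`, and `Q` keeps track of the letters it may use. The double negation is
-- there because no procedure tells whether a later prefix of an infinite word still moves a
-- sequence; every use ends in a stable goal.
Compact : (Letter → Set) → Rel 𝒮 0ℓ → Set
Compact Q r = ∀ σs → ¬ ¬ ∃ λ L → All Q L × All (Agrees r L) σs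

agrees-++ : ∀ {r r′ s : Rel 𝒮 0ℓ} → (∀ {σ x τ} → r σ x → r′ x τ → s σ τ) → ∀ L M σs →
            All (Agrees r L) σs → All (Agrees r′ M) (map (run L) σs) → All (Agrees s (L ++ M)) σs
agrees-++ j L M []       []       []         = []
agrees-++ {s = s} j L M (σ ∷ σs) (a ∷ as) (a′ ∷ as′) =
  subst (s σ) (sym (run-++ L M σ)) (j a a′) ∷ agrees-++ {s = s} j L M σs as as′

compact-⨾ : ∀ {Q} r r′ → Compact Q r → Compact Q r′ → Compact Q (r ⨾ r′)
compact-⨾ r r′ c c′ σs k = c σs λ (L , q , a) → c′ (map (run L) σs) λ (M , q′ , a′) →
  k (L ++ M , ++⁺ q q′ , agrees-++ {s = r ⨾ r′} (λ a b → _ , a , b) L M σs a a′)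

compact-prefix : ∀ {Q} w → (∀ n → Compact Q ⟦ w n ⟧) → ∀ n → Compact Q (prefix w n)
compact-prefix w c zero    σs k = k ([] , [] , All.tabulate (λ _ → refl))
compact-prefix w c (suc n) = compact-⨾ (prefix w n) ⟦ w n ⟧ (compact-prefix w c n) (c n)

totalSize : List 𝒮 → ℕ
totalSize []       = 0
totalSize (σ ∷ σs) = size (terms σ) + totalSize σs

totalSize-run : ∀ L σs → totalSize (map (run L) σs) ≤ totalSize σs
totalSize-run L []       = z≤n
totalSize-run L (σ ∷ σs) = +-mono-≤ (size-mono (run-⊆ L σ)) (totalSize-run L σs)

totalSize-equal : ∀ L σs → totalSize σs ≤ totalSize (map (run L) σs) →
                  All (λ σ → run L σ ≡ σ) σs
totalSize-equal L []       _  = []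
totalSize-equal L (σ ∷ σs) le =
  𝒮-≡ (size-equal (run-⊆ L σ) (+-cancelʳ-≤ (totalSize σs) _ _
    (≤-trans le (+-monoʳ-≤ (size (terms (run L σ))) (totalSize-run L σs))))) ∷
  totalSize-equal L σs (+-cancelˡ-≤ (size (terms σ)) _ _
    (≤-trans le (+-monoˡ-≤ (totalSize (map (run L) σs)) (size-mono (run-⊆ L σ)))))

-- Either some prefix strictly shrinks the given sequences, and the induction
-- on their total size applies to what follows it, or no prefix moves them.
compact-∞ : ∀ {Q} k w → (∀ n → Compact Q ⟦ w n ⟧) → ∀ σs → totalSize σs < k →
            ¬ ¬ ∃ λ L → All Q L × All (Agrees ⟦ ∞ w ⟧ L) σs
compact-∞ {Q} (suc k) w c σs bound ¬goal = ¬¬-excluded-middle {A = Shrinks} λ where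
    (yes (n , L , q , as , lt)) →
      compact-∞ k (w ≫ n) (λ i → c (i + n)) (map (run L) σs) (≤-trans lt (s≤s⁻¹ bound))
        λ (M , q′ , as′) →
          ¬goal (L ++ M , ++⁺ q q′ , agrees-++ {s = ⟦ ∞ w ⟧} (∞-join w n) L M σs as as′)
    (no ¬shrink) → ¬goal ([] , [] , All.tabulate λ {σ} σ∈ → 0 , refl , λ n _ τ i →
      𝒮-≡ (size-equal (prefix-⊆ w n i) (decidable-stable (_ ≤? _) λ ≰ →
        compact-prefix w c n σs λ (L , q , as) → ≰
          (≤-reflexive (cong (size ∘ terms) (trans
            (sym (All.lookup (totalSize-equal L σs (≮⇒≥ (λ lt → ¬shrink (n , L , q , as , lt)))) σ∈))
            (prefix-functional w n (All.lookup as σ∈) i)))))))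
  where
  Shrinks : Set
  Shrinks = ∃₂ λ n L → All Q L × All (Agrees (prefix w n) L) σs ×
                       totalSize (map (run L) σs) < totalSize σs

compact : ∀ {Q} w → AllLetters Q w → Compact Q ⟦ w ⟧
compact ε        _        σs k = k ([] , [] , All.tabulate (λ _ → refl))
compact [ ℓ ]    q        σs k = k (ℓ ∷ [] , q ∷ [] , All.tabulate (λ _ → refl))
compact (w · w′) (q , q′)      = compact-⨾ ⟦ w ⟧ ⟦ w′ ⟧ (compact w q) (compact w′ q′)
compact (∞ w)    q        σs   = compact-∞ _ w (λ n → compact (w n) (q n)) σs ≤-refl

total : ∀ w σ → ¬ ¬ ∃ (⟦ w ⟧ σ)
total w σ k = compact w (allLetters w) (σ ∷ []) λ where
  (L , _ , a ∷ []) → k (run L σ , a)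

-- Improvements of a word

infix 4 _⊴_ _↗_

-- Inclusion alone is not preserved: `ρ₃` keeps the pair (1 , 0) but deletes the larger (1 , 1). In
-- the second case all later words fix `ts` and can only shrink `us`.
_⊴_ : Rel (List Term) 0ℓ
us ⊴ ts = us ≡ ts ⊎ (¬ Active ts × us ⊆ ts)

_↗_ : Rel Word 0ℓ
w ↗ w′ = ∀ {σ τ τ′} → ⟦ w ⟧ σ τ → ⟦ w′ ⟧ σ τ′ → ¬ ¬ (terms τ ⊴ terms τ′)

↗-from : ∀ w w′ → w ↗ w′ → ∀ {x x′ τ τ′} → terms x ⊴ terms x′ →
         ⟦ w ⟧ x τ → ⟦ w′ ⟧ x′ τ′ → ¬ ¬ (terms τ ⊴ terms τ′)
↗-from w w′ up {x} {x′} (inj₁ e) s s′ k with refl ← 𝒮-≡ {x} {x′} e = up s s′ k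
↗-from w w′ up (inj₂ (¬a , i)) s s′ k with refl ← functional w′ (fixed-inactive w′ ¬a) s′ =
  k (inj₂ (¬a , ⊆-trans (word-⊆ w s) i))

↗-refl : ∀ w → w ↗ w
↗-refl w s s′ k = k (inj₁ (cong terms (functional w s s′)))

↗-· : ∀ w w′ u u′ → w ↗ w′ → u ↗ u′ → w · u ↗ w′ · u′
↗-· w w′ u u′ up up′ (_ , s , t) (_ , s′ , t′) k =
  up s s′ λ x⊴x′ → ↗-from u u′ up′ x⊴x′ t t′ k

↗-∞ : ∀ w w′ → (∀ n → w n ↗ w′ n) → ∞ w ↗ ∞ w′
↗-∞ w w′ up {σ} {τ} {τ′} (N , i , e) (N′ , i′ , e′) k =
  -- Both eventual values are read off at the common index `N ⊔ N′`, where the prefixes have values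
  -- by compactness.
  prefix-total w λ (x , j) → prefix-total w′ λ (x′ , j′) → improves (N ⊔ N′) j j′ λ x⊴x′ →
    k (subst (_⊴ terms τ′) (cong terms (e (N ⊔ N′) (m≤m⊔n N N′) x j))
        (subst (terms x ⊴_) (cong terms (e′ (N ⊔ N′) (m≤n⊔m N N′) x′ j′)) x⊴x′))
  where
  prefix-total : ∀ w → ¬ ¬ ∃ (prefix w (N ⊔ N′) σ)
  prefix-total w k = compact-prefix w (λ n → compact (w n) (allLetters (w n))) (N ⊔ N′) (σ ∷ [])
    λ where (L , _ , a ∷ []) → k (run L σ , a)
  improves : ∀ n {x x′} → prefix w n σ x → prefix w′ n σ x′ → ¬ ¬ (terms x ⊴ terms x′)
  improves zero    refl        refl          k = k (inj₁ refl)
  improves (suc n) (_ , j , s) (_ , j′ , s′) k =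
    improves n j j′ λ y⊴y′ → ↗-from (w n) (w′ n) (up n) y⊴y′ s s′ k

↗⇒≼ : ∀ w w′ → w ↗ w′ → w ≼ w′
↗⇒≼ w w′ up σ τ τ′ s s′ z = decidable-stable (_ ≤? _) λ ≰ → up s s′ λ where
  (inj₁ e)       → ≰ (≤-reflexive (cong (countTerms z) e))
  (inj₂ (_ , i)) → ≰ (countTerms-mono z i)

↗-wellFormed : ∀ w w′ → w ↗ w′ → WellFormed w → WellFormed w′
↗-wellFormed w w′ up wf σ τ′ s′ τ′∈𝒮₀ = total w σ λ (τ , s) → up s s′ λ where
  (inj₁ e)        → wf σ τ s (subst 𝒮₀ (sym (𝒮-≡ {τ} {τ′} e)) τ′∈𝒮₀)
  (inj₂ (¬a , _)) → ¬a (𝒮₀⇒Active τ′ τ′∈𝒮₀)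

-- Action on the pairs after an active first pair

tailAct : Letter → List Term → List Term
tailAct ρ₄ (⟨ n , _ , m ⟩ ∷ ts) = ⟨ n , 0 , m ⟩ ∷₀ ts
tailAct ρ₅ (⟨ n , p , _ ⟩ ∷ ts) = ⟨ n , p , 0 ⟩ ∷₀ ts
tailAct _  ts                   = ts

tailRun : List Letter → List Term → List Term
tailRun []      ts = ts
tailRun (ℓ ∷ L) ts = tailRun L (tailAct ℓ ts)

tailRun-[] : ∀ L → tailRun L [] ≡ []
tailRun-[] []       = refl
tailRun-[] (ρ₁ ∷ L) = tailRun-[] L
tailRun-[] (ρ₂ ∷ L) = tailRun-[] L
tailRun-[] (ρ₃ ∷ L) = tailRun-[] L
tailRun-[] (ρ₄ ∷ L) = tailRun-[] L
tailRun-[] (ρ₅ ∷ L) = tailRun-[] L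

tailAct-⊆ : ∀ ℓ ts → tailAct ℓ ts ⊆ ts
tailAct-⊆ ρ₁ _       = ⊆-refl
tailAct-⊆ ρ₂ _       = ⊆-refl
tailAct-⊆ ρ₃ _       = ⊆-refl
tailAct-⊆ ρ₄ []      = []
tailAct-⊆ ρ₄ (_ ∷ _) = ∷₀-⊆ z≤n ≤-refl ⊆-refl
tailAct-⊆ ρ₅ []      = []
tailAct-⊆ ρ₅ (_ ∷ _) = ∷₀-⊆ ≤-refl z≤n ⊆-refl

tailRun-⊆ : ∀ L ts → tailRun L ts ⊆ ts
tailRun-⊆ []      ts = ⊆-refl
tailRun-⊆ (ℓ ∷ L) ts = ⊆-trans (tailRun-⊆ L _) (tailAct-⊆ ℓ ts)

Is₄₅ : Letter → Set
Is₄₅ ℓ = ∃ λ j → ℓ ≡ letter j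

act-letter : ∀ j {n p m} ts → actTerms (letter j) (⟨ n , suc p , suc m ⟩ ∷ ts) ≡
             ⟨ n , suc p , suc m ⟩ ∷ tailAct (letter j) ts
act-letter four []      = refl
act-letter four (_ ∷ _) = refl
act-letter five []      = refl
act-letter five (_ ∷ _) = refl

run-letters : ∀ {L n p m} → All Is₄₅ L → ∀ ts →
              runₗ L (⟨ n , suc p , suc m ⟩ ∷ ts) ≡ ⟨ n , suc p , suc m ⟩ ∷ tailRun L ts
run-letters []               ts = refl
run-letters {_ ∷ L} ((j , refl) ∷ q) ts = trans (cong (runₗ L) (act-letter j ts)) (run-letters q _)

other : Letter₄₅ → Letter₄₅
other four = five
other five = four

-- Exponents of an active pair are written suc p and suc m, so that ρ₁ and ρ₂
-- set p and m to 0.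
cap : Bool → ℕ → ℕ
cap true  _ = 0
cap false p = p

-- This is `ρ₃` on the pair (`suc p` , `suc m`): lowering both entries by one leaves their
-- difference, hence the outcome, unchanged.
cancel : ℕ → ℕ → ℕ → List Term → List Term
cancel n p m ts = ⟨ n , p ∸ (p ⊓ m) , m ∸ (p ⊓ m) ⟩ ∷₀ ts

closing : Bool → Bool → List Letter
closing true  true  = ρ₁ ∷ ρ₂ ∷ ρ₃ ∷ []
closing true  false = ρ₁ ∷ ρ₃ ∷ []
closing false true  = ρ₂ ∷ ρ₃ ∷ []
closing false false = ρ₃ ∷ []

closingWord : Bool → Bool → Word
closingWord a b = ρ₁ ^ a · ρ₂ ^ b · [ ρ₃ ]

closingWord-run : ∀ a b σ → ⟦ closingWord a b ⟧ σ (run (closing a b) σ)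
closingWord-run true  true  σ = _ , refl , _ , refl , refl
closingWord-run true  false σ = _ , refl , _ , refl , refl
closingWord-run false true  σ = _ , refl , _ , refl , refl
closingWord-run false false σ = _ , refl , _ , refl , refl

closing-active : ∀ a b n p m ts → runₗ (closing a b) (⟨ n , suc p , suc m ⟩ ∷ ts) ≡
                 cancel n (cap a p) (cap b m) ts
closing-active true  true  n p m ts = refl
closing-active true  false n p m ts = refl
closing-active false true  n p m ts = refl
closing-active false false n p m ts = refl

cancel-view : ∀ n p m → (∀ ts → cancel n p m ts ≡ ts) ⊎
              ∃ λ t → (∀ ts → ¬ Active (t ∷ ts)) × (∀ ts → cancel n p m ts ≡ t ∷ ts)
cancel-view n zero    zero    = inj₁ λ _ → refl
cancel-view n zero    (suc m) = inj₂ (⟨ n , 0 , suc m ⟩ , (λ _ ()) , λ _ → refl)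
cancel-view n (suc p) zero    = inj₂ (⟨ n , suc p , 0 ⟩ , (λ _ ()) , λ _ → refl)
cancel-view n (suc p) (suc m) = cancel-view n p m

cancel-inactive : ∀ n p m {ts} → ¬ Active ts → ¬ Active (cancel n p m ts)
cancel-inactive n p m {ts} ¬a with cancel-view n p m
... | inj₁ gone         = subst (¬_ ∘ Active) (sym (gone ts)) ¬a
... | inj₂ (_ , i , eq) = subst (¬_ ∘ Active) (sym (eq ts)) (i ts)

both-killed : ∀ j {n p m} ts →
  tailAct (letter (other j)) (tailAct (letter j) (⟨ n , suc p , suc m ⟩ ∷ ts)) ≡ ts
both-killed four ts = refl
both-killed five ts = refl

-- If the pair behind an active first pair has become ts = (p , m) ∷ us with
-- p, m > 0, then ρⱼ and ρ_other j delete it, whereas without them it is the next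
-- active pair and W acts on us all the same; if p or m is 0, stopping at ts is
-- the better outcome.
postpone-⊴ : ∀ j {W} → All Is₄₅ W → ∀ a b ts →
  runₗ (closing a b) (runₗ W (actTerms (letter (other j)) (actTerms (letter j) ts))) ⊴
  runₗ (closing a b) (runₗ W (runₗ (closing a b) ts))
postpone-⊴ j {W} q a b ts with activity ts
... | isInactive ¬a
  rewrite actTerms-inactive (letter j) ¬a | actTerms-inactive (letter (other j)) ¬a
        | runₗ-inactive (closing a b) ¬a = inj₁ refl
... | isActive n p m us
  rewrite act-letter j {n} {p} {m} us
        | act-letter (other j) {n} {p} {m} (tailAct (letter j) us)
        | run-letters {n = n} {p} {m} q (tailAct (letter (other j)) (tailAct (letter j) us))
        | closing-active a b n p m us
        | closing-active a b n p m
            (tailRun W (tailAct (letter (other j)) (tailAct (letter j) us)))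
  with cancel-view n (cap a p) (cap b m)
...  | inj₂ (t , i , eq)
  rewrite eq us | eq (tailRun W (tailAct (letter (other j)) (tailAct (letter j) us)))
        | runₗ-inactive W (i us) | runₗ-inactive (closing a b) (i us) =
  inj₂ (i us , keep ≤-refl ≤-refl (shrinks us))
  where
  shrinks : ∀ us → tailRun W (tailAct (letter (other j)) (tailAct (letter j) us)) ⊆ us
  shrinks us = ⊆-trans (tailRun-⊆ W _) (⊆-trans (tailAct-⊆ (letter (other j)) _) (tailAct-⊆ (letter j) us))
...  | inj₁ gone
  rewrite gone us | gone (tailRun W (tailAct (letter (other j)) (tailAct (letter j) us)))
  with activity us
...   | isInactive ¬a
  rewrite runₗ-inactive W ¬a | runₗ-inactive (closing a b) ¬a =
  inj₂ (¬a , ⊆-trans (tailRun-⊆ W _) (⊆-trans (tailAct-⊆ (letter (other j)) _) (tailAct-⊆ (letter j) us)))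
...   | isActive n′ p′ m′ xs
  rewrite both-killed j {n′} {p′} {m′} xs | run-letters {n = n′} {p′} {m′} q xs
        | closing-active a b n′ p′ m′ (tailRun W xs)
  with cancel-view n′ (cap a p′) (cap b m′)
...    | inj₁ gone′         = inj₁ (sym (gone′ (tailRun W xs)))
...    | inj₂ (t , i , eq) rewrite eq (tailRun W xs) = inj₂ (i _ , skip ⊆-refl)

-- Test sequences

∅ : 𝒮
∅ = mk𝒮 [] [] []

top : List Term → ℕ
top []      = 0
top (t ∷ _) = abs t

below-top : ∀ ts → AllPairs (_>_ on abs) ts → All (λ t → suc (top ts) > abs t) ts
below-top []       _       = []
below-top (t ∷ ts) (d ∷ _) = ≤-refl ∷ All.map m≤n⇒m≤1+n d

push : ∀ p m → .(1 ≤ p + m) → 𝒮 → 𝒮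
push p m q (mk𝒮 ts nz ds) =
  mk𝒮 (⟨ suc (top ts) , p , m ⟩ ∷ ts) ((s≤s z≤n , q) ∷ nz) (below-top ts ds ∷ ds)

pos₁ neg₁ : Letter₄₅ → ℕ
pos₁ four = 1
pos₁ five = 0
neg₁ four = 0
neg₁ five = 1

-- The one-term pair that `letter j` deletes and the other letter leaves alone. A row of them counts
-- how many letters `letter j` have acted.
lone : Letter₄₅ → ℕ → Term
lone j n = ⟨ n , pos₁ j , neg₁ j ⟩

lone-nonzero : ∀ j → 1 ≤ pos₁ j + neg₁ j
lone-nonzero four = s≤s z≤n
lone-nonzero five = s≤s z≤n

pushLone : Letter₄₅ → 𝒮 → 𝒮
pushLone j = push (pos₁ j) (neg₁ j) (lone-nonzero j)

pushLones : List Letter₄₅ → 𝒮 → 𝒮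
pushLones js σ = foldr pushLone σ js

push₁₁ : 𝒮 → 𝒮
push₁₁ = push 1 1 (s≤s z≤n)

lone-inactive : ∀ j {n} ts → ¬ Active (lone j n ∷ ts)
lone-inactive four ts ()
lone-inactive five ts ()

tailAct-lone : ∀ j {n} ts → tailAct (letter j) (lone j n ∷ ts) ≡ ts
tailAct-lone four ts = refl
tailAct-lone five ts = refl

tailAct-lone-other : ∀ j {n} ts →
  tailAct (letter j) (lone (other j) n ∷ ts) ≡ lone (other j) n ∷ ts
tailAct-lone-other four ts = refl
tailAct-lone-other five ts = refl

≢⇒other : ∀ {i j} → i ≢ j → j ≡ other i
≢⇒other {four} {four} i≢j = contradiction refl i≢j
≢⇒other {four} {five} _   = refl
≢⇒other {five} {four} _   = refl
≢⇒other {five} {five} i≢j = contradiction refl i≢j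

-- Words over ρ₄ and ρ₅

-- Eventual values are not computable in general, so the point of stabilisation is supplied as a
-- hypothesis; `n` need not be the least one.
star-run : ∀ n ℓ {σ} → act ℓ (run (replicate n ℓ) σ) ≡ run (replicate n ℓ) σ →
           ⟦ [ ℓ ] * ⟧ σ (run (replicate n ℓ) σ)
star-run zero    ℓ eq = fixed {_≡ ℓ} ([ ℓ ] *) (λ { refl → eq }) (λ _ → refl)
star-run (suc n) ℓ eq = ∞-cons (λ _ → [ ℓ ]) refl (star-run n ℓ eq)

power-run : ∀ n ℓ σ → ⟦ power [ ℓ ] n ⟧ σ (run (replicate n ℓ) σ)
power-run zero    ℓ σ = refl
power-run (suc n) ℓ σ = _ , refl , power-run n ℓ (act ℓ σ)

power-comm : ∀ w k {σ τ} → ⟦ power w k · w ⟧ σ τ → ⟦ w · power w k ⟧ σ τ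
power-comm w zero    (_ , refl , s)        = _ , s , refl
power-comm w (suc k) (x , (y , s , p) , s′) = y , s , power-comm w k (x , p , s′)

AllLetters-power : ∀ {Q} ℓ k → Q ℓ → AllLetters Q (power [ ℓ ] k)
AllLetters-power ℓ zero    q = tt
AllLetters-power ℓ (suc k) q = q , AllLetters-power ℓ k q

blockWord-letters : ∀ c → AllLetters Is₄₅ (blockWord c)
blockWord-letters (j , 1+ k) = AllLetters-power (letter j) (suc k) (j , refl)
blockWord-letters (j , ∗)    = λ _ → j , refl

blocks-letters : ∀ bs → AllLetters Is₄₅ (foldr (λ c w → blockWord c · w) ε bs)
blocks-letters []       = tt
blocks-letters (c ∷ bs) = blockWord-letters c , blocks-letters bs

word₄₅-letters : ∀ ω → AllLetters Is₄₅ (word₄₅ ω)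
word₄₅-letters (blocks bs _) = blocks-letters bs
word₄₅-letters ⟨ρ₄ρ₅⟩*       = λ _ → (four , refl) , five , refl

-- Exposes a final `letter j`, so that a change of block becomes two adjacent letters. For an
-- infinite block this is the absorption of `ρⱼ` by `ρⱼ*`: the value at index `suc N` is again the
-- eventual one.
block-last : ∀ j e → ∃ λ A → AllLetters (_≡ letter j) A ×
             (∀ {σ τ} → ⟦ A · [ letter j ] ⟧ σ τ → ⟦ blockWord (j , e) ⟧ σ τ)
block-last j (1+ k) =
  power [ letter j ] k , AllLetters-power (letter j) k refl , power-comm [ letter j ] k
block-last j ∗ = [ letter j ] * , (λ _ → refl) , λ (x , s , t) → absorb x s t
  where
  absorb : ∀ {σ τ} x → ⟦ [ letter j ] * ⟧ σ x → act (letter j) x ≡ τ → ⟦ [ letter j ] * ⟧ σ τ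
  absorb {σ} x s@(N , i , e) refl =
    subst (⟦ [ letter j ] * ⟧ σ) (sym (e (suc N) (n≤1+n N) _ (x , i , refl))) s

block-first : ∀ j e → ∃ λ W → AllLetters Is₄₅ W ×
              (∀ {σ τ} → ⟦ [ letter j ] · W ⟧ σ τ → ⟦ blockWord (j , e) ⟧ σ τ)
block-first j (1+ k) =
  power [ letter j ] k , AllLetters-power (letter j) k (j , refl) , id
block-first j ∗ = [ letter j ] * , (λ _ → j , refl) , λ (_ , s , t) → ∞-cons (λ _ → [ letter j ]) s t

Pure : ℒ₄₅ → Set
Pure ω = ω ∈ℒ four ⊎ ω ∈ℒ five

-- One direction in `change` is enough: words are functional, so a value found along the split word
-- is the value of `ω`.
record Mixed (ω : ℒ₄₅) : Set where
  constructor mixed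
  field
    j         : Letter₄₅
    A W       : Word
    A-letters : AllLetters (_≡ letter j) A
    W-letters : AllLetters Is₄₅ W
    change    : ∀ {σ τ} → ⟦ A · [ letter j ] · [ letter (other j) ] · W ⟧ σ τ →
                ⟦ word₄₅ ω ⟧ σ τ

pure-or-mixed : ∀ ω → Pure ω ⊎ Mixed ω
pure-or-mixed (blocks [] _)                = inj₁ (inj₁ [])
pure-or-mixed (blocks ((four , _) ∷ []) _) = inj₁ (inj₁ (refl ∷ []))
pure-or-mixed (blocks ((five , _) ∷ []) _) = inj₁ (inj₂ (refl ∷ []))
pure-or-mixed (blocks ((j , e) ∷ (j′ , e′) ∷ bs) (j≢j′ ∷ _)) with refl ← ≢⇒other j≢j′ =
  let A , qA , last  = block-last j e
      W , qW , first = block-first (other j) e′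
  in inj₂ (mixed j A (W · foldr (λ c w → blockWord c · w) ε bs) qA (qW , blocks-letters bs)
       λ (_ , s , _ , s′ , _ , s″ , _ , t , u) →
         _ , last (_ , s , s′) , _ , first (_ , s″ , t) , u)
pure-or-mixed ⟨ρ₄ρ₅⟩* =
  inj₂ (mixed four ε (([ ρ₄ ] · [ ρ₅ ]) *) tt (λ _ → (four , refl) , five , refl)
    λ { (_ , refl , _ , s , _ , s′ , t) → ∞-cons (λ _ → [ ρ₄ ] · [ ρ₅ ]) (_ , s , s′) t })

-- Improving the factors that violate the condition

Good : Factor → Set
Good T = Pure (ω T) × (a T , b T) ≢ (true , true)

-- Both `∅` and the stopped `τ` are fixed by whatever follows, so the discrepancy persists in
-- products, and it is visible to `v` because `v ∅` is 0.
Strict : Rel Word 0ℓ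
Strict w w′ = ∃₂ λ σ τ → ⟦ w ⟧ σ ∅ × ⟦ w′ ⟧ σ τ × ¬ Active (terms τ) × v τ ≢ + 0

Better : Factor → Word → Set
Better T X = factorWord T ↗ X × ((Good T × X ≡ factorWord T) ⊎ Strict (factorWord T) X)

lower : Factor → Factor
lower (factor ω true true) = factor ω false false
lower T                    = T

-- `ρ₁ρ₂ρ₃` turns an active first pair into (1 , 1) and deletes it. `ρ₃` alone does the same if the
-- entries are equal, and otherwise leaves a surplus of one sign, which stops.
closing-⊴ : ∀ ts → runₗ (closing true true) ts ⊴ runₗ (closing false false) ts
closing-⊴ ts with activity ts
... | isInactive ¬a rewrite runₗ-inactive (closing true true) ¬a | runₗ-inactive (closing false false) ¬a =
  inj₁ refl
... | isActive n p m us with cancel-view n p m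
...   | inj₁ gone         = inj₁ (sym (gone us))
...   | inj₂ (t , i , eq) = inj₂ (subst (¬_ ∘ Active) (sym (eq us)) (i us) ,
                                  subst (us ⊆_) (sym (eq us)) (skip ⊆-refl))

closingWord-value : ∀ a b {σ τ} → ⟦ closingWord a b ⟧ σ τ → terms τ ≡ runₗ (closing a b) (terms σ)
closingWord-value a b {σ} s =
  trans (cong terms (functional (closingWord a b) s (closingWord-run a b σ))) (terms-run (closing a b) σ)

lower-better : ∀ ω → Better (factor ω true true) (factorWord (factor ω false false))
lower-better ω = up , inj₂ (σ , run (closing false false) σ ,
    (σ , stays , closingWord-run true true σ) , (σ , stays , closingWord-run false false σ) ,
    (λ ()) , λ ())
  where
  up : factorWord (factor ω true true) ↗ factorWord (factor ω false false)
  up (x , s , t) (_ , s′ , t′) k with refl ← functional (word₄₅ ω) s s′ =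
    k (subst₂ _⊴_ (sym (closingWord-value true true {x} t)) (sym (closingWord-value false false {x} t′))
      (closing-⊴ (terms x)))
  -- Unequal entries and no second pair: `ρ₄` and `ρ₅` are idle, `ρ₁ρ₂ρ₃` empties the sequence and
  -- `ρ₃` leaves one positive term.
  σ = push 2 1 (s≤s z≤n) ∅
  stays : ⟦ word₄₅ ω ⟧ σ σ
  stays = fixed (word₄₅ ω) (λ { (four , refl) → refl ; (five , refl) → refl }) (word₄₅-letters ω)

postpone-better : ∀ ω → (M : Mixed ω) → ∀ a b →
  Better (factor ω a b) (Mixed.A M · closingWord a b · Mixed.W M · closingWord a b)
postpone-better ω (mixed j A W qA qW change) a b = up , inj₂ (σ j , τ j ,
    (_ , change (σ j , A-fixed j qA , _ , refl , _ , refl , W-fixed j) ,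
      subst (⟦ closingWord a b ⟧ _) (cancelled a b j) (closingWord-run a b _)) ,
    (σ j , A-fixed j qA ,
     τ j , subst (⟦ closingWord a b ⟧ (σ j)) (stuck a b j) (closingWord-run a b (σ j)) ,
     fixed-inactive (W · closingWord a b) (lone-inactive (other j) [])) ,
    lone-inactive (other j) [] , v≢0 j)
  where
  -- The second pair of `σ j` survives the letters of `A` and is deleted only at the change of
  -- letter. Closing before the change cancels (1 , 1) first and stops at `τ j`.
  σ τ : Letter₄₅ → 𝒮
  τ j = pushLone (other j) ∅
  σ j = push₁₁ (τ j)
  A-fixed : ∀ j → AllLetters (_≡ letter j) A → ⟦ A ⟧ (σ j) (σ j)
  A-fixed four = fixed A λ { refl → refl }
  A-fixed five = fixed A λ { refl → refl }
  W-fixed : ∀ j → let x = act (letter (other j)) (act (letter j) (σ j)) in ⟦ W ⟧ x x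
  W-fixed four = fixed W (λ { (four , refl) → refl ; (five , refl) → refl }) qW
  W-fixed five = fixed W (λ { (four , refl) → refl ; (five , refl) → refl }) qW
  cancelled : ∀ a b j → run (closing a b) (act (letter (other j)) (act (letter j) (σ j))) ≡ ∅
  cancelled true  true  four = refl
  cancelled true  true  five = refl
  cancelled true  false four = refl
  cancelled true  false five = refl
  cancelled false true  four = refl
  cancelled false true  five = refl
  cancelled false false four = refl
  cancelled false false five = refl
  stuck : ∀ a b j → run (closing a b) (σ j) ≡ τ j
  stuck true  true  four = refl
  stuck true  true  five = refl
  stuck true  false four = refl
  stuck true  false five = refl
  stuck false true  four = refl
  stuck false true  five = refl
  stuck false false four = refl
  stuck false false five = refl
  v≢0 : ∀ j → v (τ j) ≢ + 0
  v≢0 four ()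
  v≢0 five ()
  up : factorWord (factor ω a b) ↗ (A · closingWord a b · W · closingWord a b)
  up (_ , s , t) (z , s₁ , z₁ , t₁ , z₂ , s₂ , t₂) k =
    -- `W` may be infinite, whereas `postpone-⊴` needs a finite word. It is applied to two sequences
    -- only, so one finite `L` in `ρ₄`, `ρ₅` replaces both occurrences.
    compact W qW (act (letter (other j)) (act (letter j) z) ∷ z₁ ∷ []) λ where
      (L , q , agree ∷ agree₁ ∷ []) → k (subst₂ _⊴_
        (trans (cong (runₗ (closing a b))
          (trans (sym (terms-run L _))
            (cong terms (functional (word₄₅ ω) (change (z , s₁ , _ , refl , _ , refl , agree)) s))))
          (sym (closingWord-value a b t)))
        (trans (cong (runₗ (closing a b))
          (trans (cong (runₗ L) (sym (closingWord-value a b t₁)))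
            (trans (sym (terms-run L z₁)) (cong terms (functional W agree₁ s₂)))))
          (sym (closingWord-value a b t₂)))
        (postpone-⊴ j q a b (terms z)))

better : ∀ T → ∃ (Better T)
better (factor ω a b) with pure-or-mixed ω
... | inj₂ M = _ , postpone-better ω M a b
better (factor ω true  true)    | inj₁ _ = _ , lower-better ω
better T@(factor _ true  false) | inj₁ p = _ , ↗-refl (factorWord T) , inj₁ ((p , λ ()) , refl)
better T@(factor _ false true)  | inj₁ p = _ , ↗-refl (factorWord T) , inj₁ ((p , λ ()) , refl)
better T@(factor _ false false) | inj₁ p = _ , ↗-refl (factorWord T) , inj₁ ((p , λ ()) , refl)

-- Sequences reaching the factors behind a factor that is not final

-- One term suffices for an infinite block: the next one belongs to the following block, on the
-- other letter, and brings `ρⱼ*` to rest. Hence the need for a finite last block.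
eaten : List Block → List Letter₄₅
eaten []                = []
eaten ((j , 1+ k) ∷ bs) = replicate (suc k) j ++ eaten bs
eaten ((j , ∗) ∷ bs)    = j ∷ eaten bs

power-eats : ∀ k j js {σ σ′ n} → terms σ ≡ ⟨ n , 1 , 1 ⟩ ∷ terms (pushLones (replicate k j ++ js) σ′) →
  ∃ λ τ → ⟦ power [ letter j ] k ⟧ σ τ × terms τ ≡ ⟨ n , 1 , 1 ⟩ ∷ terms (pushLones js σ′)
power-eats zero    j js {σ} eq = σ , refl , eq
power-eats (suc k) j js {σ} {σ′} {n} eq =
  let τ , s , eq′ = power-eats k j js {act (letter j) σ} {σ′}
        (trans (cong (actTerms (letter j)) eq) (trans (act-letter j _) (cong (⟨ n , 1 , 1 ⟩ ∷_) (tailAct-lone j _))))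
  in τ , (_ , refl , s) , eq′

blocks-eat : ∀ bs → Linked (_≢_ on proj₁) bs → ¬ LastBlockInfinite bs → ∀ {σ σ′ n} →
  terms σ ≡ ⟨ n , 1 , 1 ⟩ ∷ terms (pushLones (eaten bs) σ′) →
  ∃ λ τ → ⟦ foldr (λ c w → blockWord c · w) ε bs ⟧ σ τ × terms τ ≡ ⟨ n , 1 , 1 ⟩ ∷ terms σ′
blocks-eat []                        _        _   {σ} eq = σ , refl , eq
blocks-eat ((j , ∗) ∷ [])            _        ¬∞      eq = contradiction refl ¬∞
blocks-eat ((j , 1+ k) ∷ [])         _        _   {σ} {σ′} eq =
  let τ , s , eq′ = power-eats (suc k) j [] {σ} {σ′} eq in τ , (_ , s , refl) , eq′
blocks-eat ((j , 1+ k) ∷ bs@(_ ∷ _)) (_ ∷ l)  ¬∞  {σ} {σ′} eq =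
  let x , s , eq′ = power-eats (suc k) j (eaten bs) {σ} {σ′} eq
      τ , t , eq″ = blocks-eat bs l ¬∞ {x} {σ′} eq′
  in τ , (x , s , t) , eq″
blocks-eat ((j , ∗) ∷ bs@((j′ , e) ∷ bs′)) (j≢j′ ∷ l) ¬∞ {σ} {σ′} {n} eq
  with refl ← ≢⇒other j≢j′ =
  let τ , t , eq″ = blocks-eat bs l ¬∞ {x} {σ′} eq′
  in τ , (x , star-run 1 (letter j) {σ} (𝒮-≡ (stays e eq′)) , t) , eq″
  where
  x = act (letter j) σ
  eq′ : terms x ≡ ⟨ n , 1 , 1 ⟩ ∷ terms (pushLones (eaten bs) σ′)
  eq′ = trans (cong (actTerms (letter j)) eq)
          (trans (act-letter j _) (cong (⟨ n , 1 , 1 ⟩ ∷_) (tailAct-lone j _)))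
  stays : ∀ e → terms x ≡ ⟨ n , 1 , 1 ⟩ ∷ terms (pushLones (eaten ((other j , e) ∷ bs′)) σ′) →
          actTerms (letter j) (terms x) ≡ terms x
  stays e eq′ rewrite eq′ = trans (act-letter j _) (cong (⟨ n , 1 , 1 ⟩ ∷_) (survives e))
    where
    survives : ∀ e → let ts = terms (pushLones (eaten ((other j , e) ∷ bs′)) σ′) in
               tailAct (letter j) ts ≡ ts
    survives (1+ _) = tailAct-lone-other j _
    survives ∗      = tailAct-lone-other j _

-- A first pair (1 , 1) vanishes for every choice of `a` and `b`, and the terms in between are
-- exactly used up by `ω`. This surjectivity is what cancels a common first factor from an
-- equivalence.
reaches : ∀ T → ¬ Final (ω T) → ∀ σ′ → ∃ λ σ → ⟦ factorWord T ⟧ σ σ′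
reaches (factor ⟨ρ₄ρ₅⟩* a b)       ¬final σ′ = contradiction tt ¬final
reaches (factor (blocks bs l) a b) ¬final σ′ =
  let σ = push₁₁ (pushLones (eaten bs) σ′)
      τ , s , eq = blocks-eat bs l ¬final {σ} {σ′} refl
  in σ , τ , s , subst (⟦ closingWord a b ⟧ τ)
       (𝒮-≡ (trans (terms-run (closing a b) τ) (trans (cong (runₗ (closing a b)) eq) (cancels a b))))
       (closingWord-run a b τ)
  where
  cancels : ∀ a b {n ts} → runₗ (closing a b) (⟨ n , 1 , 1 ⟩ ∷ ts) ≡ ts
  cancels true  true  = refl
  cancels true  false = refl
  cancels false true  = refl
  cancels false false = refl

-- Necessity

¬strict : ∀ w w′ → Strict w w′ → ¬ w′ ∼ w
¬strict w w′ (σ , τ , s , s′ , _ , v≢0) eq = v≢0 (eq σ τ ∅ s′ s)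

strict-· : ∀ w w′ u u′ → Strict w w′ → Strict (w · u) (w′ · u′)
strict-· w w′ u u′ (σ , τ , s , s′ , ¬a , v≢0) =
  σ , τ , (_ , s , fixed-inactive u λ ()) , (_ , s′ , fixed-inactive u′ ¬a) , ¬a , v≢0

first-good : ∀ T X u u′ → Better T X → X · u′ ∼ factorWord T · u → Good T × X ≡ factorWord T
first-good T X u u′ (_ , inj₁ g) eq = g
first-good T X u u′ (_ , inj₂ s) eq =
  contradiction eq (¬strict (factorWord T · u) (X · u′) (strict-· (factorWord T) X u u′ s))

rest-∼ : ∀ T u u′ → ¬ Final (ω T) → factorWord T · u′ ∼ factorWord T · u → u′ ∼ u
rest-∼ T u u′ ¬final eq σ τ τ′ s s′ =
  let σ₀ , r = reaches T ¬final σ in eq σ₀ τ τ′ (σ , r , s) (σ , r , s′)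

-- The equivalence forces the first factor to be good, hence unchanged by the replacement; it is
-- then cancelled and the argument moves on to the next. Leaving `w` open covers both notions of
-- maximality.
all-good : ∀ n (Ts : ℕ → Factor) w → (∀ i → ¬ Final (ω (Ts i))) → (∀ i → Better (Ts i) (w i)) →
           ∞ w ∼ ∞ (factorWord ∘ Ts) → Good (Ts n)
all-good n Ts w nf up eq
  with first-good (Ts 0) (w 0) (∞ (factorWord ∘ Ts ≫ 1)) (∞ (w ≫ 1)) (up 0)
         (λ σ τ τ′ (_ , s , t) (_ , s′ , t′) →
           eq σ τ τ′ (∞-cons w s t) (∞-cons (factorWord ∘ Ts) s′ t′))
all-good zero    Ts w nf up eq | g , _     = g
all-good (suc n) Ts w nf up eq | _ , w₀≡T₀ =
  subst (Good ∘ Ts) (+-comm n 1)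
    (all-good n (λ i → Ts (i + 1)) (w ≫ 1) (λ i → nf (i + 1)) (λ i → up (i + 1))
      (rest-∼ (Ts 0) (∞ (factorWord ∘ Ts ≫ 1)) (∞ (w ≫ 1)) (nf 0)
        λ σ τ τ′ (x , s , t) (_ , s′ , t′) →
          eq σ τ τ′ (∞-cons w (subst (λ u → ⟦ u ⟧ σ x) (sym w₀≡T₀) s) t)
                    (∞-cons (factorWord ∘ Ts) s′ t′)))

prepend : (Factor → Word) → List Factor → Word → Word
prepend f Ts u = foldr (λ T w → f T · w) u Ts

betterWord : Factor → Word
betterWord T = proj₁ (better T)

formWord betterFormWord : List Factor → Factor → Word
formWord       Ts last = prepend factorWord Ts (factorWord last)
betterFormWord Ts last = prepend betterWord Ts (betterWord last)

formWord-↗ : ∀ Ts last → formWord Ts last ↗ betterFormWord Ts last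
formWord-↗ []       last = proj₁ (proj₂ (better last))
formWord-↗ (T ∷ Ts) last =
  ↗-· (factorWord T) (betterWord T) (formWord Ts last) (betterFormWord Ts last)
    (proj₁ (proj₂ (better T))) (formWord-↗ Ts last)

all-good-finite : ∀ Ts last → All (λ T → ¬ Final (ω T)) Ts →
                  betterFormWord Ts last ∼ formWord Ts last → All Good Ts × Good last
all-good-finite [] last _ eq with better last
... | _ , _ , inj₁ (g , _) = [] , g
... | X , _ , inj₂ s       = contradiction eq (¬strict (factorWord last) X s)
all-good-finite (T ∷ Ts) last (nf ∷ nfs) eq =
  let u = formWord Ts last
      u′ = betterFormWord Ts last
      g , X≡T = first-good T (betterWord T) u u′ (proj₂ (better T)) eq
      gs , g′ = all-good-finite Ts last nfs
        (rest-∼ T u u′ nf (subst (λ X → X · u′ ∼ factorWord T · u) X≡T eq))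
  in g ∷ gs , g′

maximal⇒good : ∀ T → MaximalInR T → EveryFactor Good T
maximal⇒good (infinite Ts nf) (wf , max) n =
  all-good n Ts (betterWord ∘ Ts) nf (λ i → proj₂ (better (Ts i)))
    (max R (↗-wellFormed T R up wf) (↗⇒≼ T R up))
  where
  T = ∞ (λ i → factorWord (Ts i))
  R = ∞ (betterWord ∘ Ts)
  up : T ↗ R
  up = ↗-∞ (factorWord ∘ Ts) (betterWord ∘ Ts) λ i → proj₁ (proj₂ (better (Ts i)))
maximal⇒good (finite Ts nfs last _) (wf , max) =
  all-good-finite Ts last nfs (max R (↗-wellFormed T R up wf) (↗⇒≼ T R up))
  where
  T = formWord Ts last
  R = betterFormWord Ts last
  up : T ↗ R
  up = formWord-↗ Ts last

maximal₁₂₃⇒good : ∀ T → MaximalInR₁₂₃ T → EveryFactor Good T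
maximal₁₂₃⇒good (infinite Ts nf) (empty , max) n =
  all-good n Ts (factorWord ∘ lower ∘ Ts) nf (λ i → better-lower (Ts i) (empty i))
    (max (infinite (lower ∘ Ts) (λ i → nf i ∘ subst Final (lower-ω (Ts i))))
      (λ i → trans (lower-ω (Ts i)) (empty i))
      (↗⇒≼ (∞ (factorWord ∘ Ts)) (∞ (factorWord ∘ lower ∘ Ts))
        (↗-∞ (factorWord ∘ Ts) (factorWord ∘ lower ∘ Ts) λ i → proj₁ (better-lower (Ts i) (empty i)))))
  where
  lower-ω : ∀ T → ω (lower T) ≡ ω T
  lower-ω (factor _ true  true)  = refl
  lower-ω (factor _ true  false) = refl
  lower-ω (factor _ false true)  = refl
  lower-ω (factor _ false false) = refl
  better-lower : ∀ T → ω T ≡ ε₄₅ → Better T (factorWord (lower T))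
  better-lower (factor ω true  true)    _    = lower-better ω
  better-lower T@(factor _ true  false) refl = ↗-refl (factorWord T) , inj₁ ((inj₁ [] , λ ()) , refl)
  better-lower T@(factor _ false true)  refl = ↗-refl (factorWord T) , inj₁ ((inj₁ [] , λ ()) , refl)
  better-lower T@(factor _ false false) refl = ↗-refl (factorWord T) , inj₁ ((inj₁ [] , λ ()) , refl)
maximal₁₂₃⇒good (finite _ _ last final) ((_ , empty) , _) = ⊥-elim (subst Final empty final)

-- Sufficiency: finitely many tests force a rule above T to agree with T

infix 4 _≤ᶜ_
_≤ᶜ_ : Rel (List Term) 0ℓ
us ≤ᶜ ts = ∀ z → countTerms z us ≤ countTerms z ts

-- What well-formedness of `R` and `T ≼ R` say about `L` at a sequence `τ` on which `R` acts as `L`.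
record Passes (T : Word) (L : List Letter) (τ : 𝒮) : Set where
  constructor passes
  field
    stopped : ¬ Active (runₗ L (terms τ))
    above   : ∀ τ′ → ⟦ T ⟧ τ τ′ → terms τ′ ≤ᶜ runₗ L (terms τ)

open Passes

record Testable (T : Word) (P : List Letter → Set) : Set where
  constructor testable
  field
    tests : List 𝒮
    sound : ∀ L → All (Passes T L) tests → P L

open Testable

test : ∀ {T} τ → Testable T (λ L → Passes T L τ)
test τ = testable (τ ∷ []) λ { _ (p ∷ []) → p }

testable-map : ∀ {T} {P Q : List Letter → Set} → (∀ L → P L → Q L) → Testable T P → Testable T Q
testable-map f t = testable (tests t) λ L ps → f L (sound t L ps)

infixr 4 _and_
_and_ : ∀ {T} {P Q : List Letter → Set} → Testable T P → Testable T Q → Testable T (λ L → P L × Q L)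
t and u = testable (tests t ++ tests u) λ L ps →
  sound t L (++⁻ˡ (tests t) ps) , sound u L (++⁻ʳ (tests t) ps)

tests-below : ∀ {T} n (f : ℕ → 𝒮) → Testable T (λ L → ∀ {i} → i < n → Passes T L (f i))
tests-below n f = testable (applyUpTo f n) λ L ps → applyUpTo⁻ f n ps

testable-⊇ : ∀ {T T′ P} → (∀ {σ τ} → ⟦ T ⟧ σ τ → ⟦ T′ ⟧ σ τ) → Testable T P → Testable T′ P
testable-⊇ sub t = testable (tests t) λ L ps →
  sound t L (All.map (λ p → passes (stopped p) λ τ′ s → above p τ′ (sub s)) ps)

-- For fixed `σ`, compactness on `σ` and its tests gives one `L` that passes them, so `R` and `T`
-- have the same value there. Equality of integers is decidable, which removes the double negation.
testable⇒maximal : ∀ T →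
  (∀ σ → Testable T (λ L → ∀ τ → ⟦ T ⟧ σ τ → runₗ L (terms σ) ≡ terms τ)) →
  ∀ R → WellFormed R → T ≼ R → R ∼ T
testable⇒maximal T t R wf T≼R σ τ τ′ s s′ = decidable-stable (v τ ℤ.≟ v τ′) λ v≢ →
  compact R (allLetters R) (σ ∷ tests (t σ)) λ where
    (L , _ , agree ∷ agrees) → v≢ (cong v (trans (functional R s agree)
      (𝒮-≡ {run L σ} {τ′} (trans (terms-run L σ) (sound (t σ) L (All.map (pass L) agrees) τ′ s′)))))
  where
  pass : ∀ L {x} → ⟦ R ⟧ x (run L x) → Passes T L x
  pass L {x} r = passes
    (λ a → wf x _ r (Active⇒𝒮₀ (run L x) (subst Active (sym (terms-run L x)) a)))
    λ y t z → subst (λ ts → countTerms z (terms y) ≤ countTerms z ts) (terms-run L x) (T≼R x y _ t r z)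

-- Finite words up to their first `ρ₃`

has₁ has₂ : List Letter → Bool
has₁ []       = false
has₁ (ρ₁ ∷ L) = true
has₁ (_ ∷ L)  = has₁ L
has₂ []       = false
has₂ (ρ₂ ∷ L) = true
has₂ (_ ∷ L)  = has₂ L

cap-zero : ∀ c → cap c 0 ≡ 0
cap-zero true  = refl
cap-zero false = refl

-- Without `ρ₃` the first pair stays active, and `ρ₁`, `ρ₂` and the letters `ρ₄`, `ρ₅` act on
-- separate data. Their relative order is therefore irrelevant.
run-before-ρ₃ : ∀ U → All (_≢ ρ₃) U → ∀ n p m ts → runₗ U (⟨ n , suc p , suc m ⟩ ∷ ts) ≡
                ⟨ n , suc (cap (has₁ U) p) , suc (cap (has₂ U) m) ⟩ ∷ tailRun U ts
run-before-ρ₃ []       []        n p m ts = refl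
run-before-ρ₃ (ρ₁ ∷ U) (_ ∷ q)  n p m ts rewrite run-before-ρ₃ U q n 0 m ts | cap-zero (has₁ U) = refl
run-before-ρ₃ (ρ₂ ∷ U) (_ ∷ q)  n p m ts rewrite run-before-ρ₃ U q n p 0 ts | cap-zero (has₂ U) = refl
run-before-ρ₃ (ρ₃ ∷ U) (≢ρ₃ ∷ _) n p m ts = contradiction refl ≢ρ₃
run-before-ρ₃ (ρ₄ ∷ U) (_ ∷ q)  n p m ts rewrite act-letter four {n} {p} {m} ts = run-before-ρ₃ U q n p m _
run-before-ρ₃ (ρ₅ ∷ U) (_ ∷ q)  n p m ts rewrite act-letter five {n} {p} {m} ts = run-before-ρ₃ U q n p m _

run-to-ρ₃ : ∀ U V → All (_≢ ρ₃) U → ∀ n p m ts → runₗ (U ++ ρ₃ ∷ V) (⟨ n , suc p , suc m ⟩ ∷ ts) ≡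
            runₗ V (cancel n (cap (has₁ U) p) (cap (has₂ U) m) (tailRun U ts))
run-to-ρ₃ U V q n p m ts =
  trans (runₗ-++ U (ρ₃ ∷ V) _) (cong (runₗ (ρ₃ ∷ V)) (run-before-ρ₃ U q n p m ts))

Split : List Letter → Set
Split L = All (_≢ ρ₃) L ⊎ ∃₂ λ U V → L ≡ U ++ ρ₃ ∷ V × All (_≢ ρ₃) U

split-∷ : ∀ {ℓ L} → ℓ ≢ ρ₃ → Split L → Split (ℓ ∷ L)
split-∷ ℓ≢ (inj₁ q)                  = inj₁ (ℓ≢ ∷ q)
split-∷ ℓ≢ (inj₂ (U , V , refl , q)) = inj₂ (_ ∷ U , V , refl , ℓ≢ ∷ q)

split-ρ₃ : ∀ L → Split L
split-ρ₃ []       = inj₁ []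
split-ρ₃ (ρ₁ ∷ L) = split-∷ (λ ()) (split-ρ₃ L)
split-ρ₃ (ρ₂ ∷ L) = split-∷ (λ ()) (split-ρ₃ L)
split-ρ₃ (ρ₃ ∷ L) = inj₂ ([] , L , refl , [])
split-ρ₃ (ρ₄ ∷ L) = split-∷ (λ ()) (split-ρ₃ L)
split-ρ₃ (ρ₅ ∷ L) = split-∷ (λ ()) (split-ρ₃ L)

repeated : ℕ → Letter₄₅ → List Letter
repeated k j = replicate k (letter j)

repeated-letters : ∀ k j → All Is₄₅ (repeated k j)
repeated-letters zero    j = []
repeated-letters (suc k) j = (j , refl) ∷ repeated-letters k j

-- Either `U` contains no `letter (other j)` and is a power of `letter j` on the tail, or the first
-- such letter finds the single term still there and deletes it.
power-tail-or-eats : ∀ j U →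
  (∃ λ c → ∀ ts → tailRun U ts ≡ tailRun (repeated c j) ts) ⊎
  (∀ n → tailRun U (lone (other j) n ∷ []) ≡ [])
power-tail-or-eats j []       = inj₁ (0 , λ _ → refl)
power-tail-or-eats j (ρ₁ ∷ U) = power-tail-or-eats j U
power-tail-or-eats j (ρ₂ ∷ U) = power-tail-or-eats j U
power-tail-or-eats j (ρ₃ ∷ U) = power-tail-or-eats j U
power-tail-or-eats four (ρ₄ ∷ U) with power-tail-or-eats four U
... | inj₁ (c , eq) = inj₁ (suc c , λ ts → eq _)
... | inj₂ eats     = inj₂ eats
power-tail-or-eats four (ρ₅ ∷ U) = inj₂ λ _ → tailRun-[] U
power-tail-or-eats five (ρ₅ ∷ U) with power-tail-or-eats five U
... | inj₁ (c , eq) = inj₁ (suc c , λ ts → eq _)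
... | inj₂ eats     = inj₂ eats
power-tail-or-eats five (ρ₄ ∷ U) = inj₂ λ _ → tailRun-[] U

tailRun-fixed : ∀ k ℓ {ts} → tailAct ℓ ts ≡ ts → tailRun (replicate k ℓ) ts ≡ ts
tailRun-fixed zero    ℓ eq = refl
tailRun-fixed (suc k) ℓ eq = trans (cong (tailRun (replicate k ℓ)) eq) (tailRun-fixed k ℓ eq)

tailRun-lones : ∀ i d j σ → tailRun (repeated (i + d) j) (terms (pushLones (replicate i j) σ)) ≡
                tailRun (repeated d j) (terms σ)
tailRun-lones zero    d j σ = refl
tailRun-lones (suc i) d j σ =
  trans (cong (tailRun (repeated (i + d) j)) (tailAct-lone j _)) (tailRun-lones i d j σ)

tailRun-pair : ∀ d j → tailRun (repeated (suc d) j) (⟨ 1 , 1 , 1 ⟩ ∷ []) ≡ lone (other j) 1 ∷ []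
tailRun-pair d four = tailRun-fixed d ρ₄ refl
tailRun-pair d five = tailRun-fixed d ρ₅ refl

cancel-11 : ∀ a b n ts → cancel n (cap a 0) (cap b 0) ts ≡ ts
cancel-11 true  true  n ts = refl
cancel-11 true  false n ts = refl
cancel-11 false true  n ts = refl
cancel-11 false false n ts = refl

lone-≰ : ∀ j → ¬ (lone j 1 ∷ []) ≤ᶜ []
lone-≰ four le = contradiction (le (+ 1)) λ ()
lone-≰ five le = contradiction (le (- (+ 1))) λ ()

-- Entries are shifted by one, so the pairs are (2 , 1), (1 , 2), (2 , 2). If `a` and `b` are both
-- false, the first two leave a term that an extra `ρ₁` or `ρ₂` would lose. If one is true, (2 , 2)
-- leaves a term whose sign tells which; any other choice leaves nothing or the opposite sign.
exponents-forced : ∀ a b u₁ u₂ → (a , b) ≢ (true , true) →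
  let forces = λ p m → cancel 1 (cap a p) (cap b m) [] ≤ᶜ cancel 1 (cap u₁ p) (cap u₂ m) [] in
  forces 1 0 → forces 0 1 → forces 1 1 → u₁ ≡ a × u₂ ≡ b
exponents-forced true  true  _     _     ab≢ _  _  _  = contradiction refl ab≢
exponents-forced false false true  true  _   le _  _  = contradiction (le (+ 1)) λ ()
exponents-forced false false true  false _   le _  _  = contradiction (le (+ 1)) λ ()
exponents-forced false false false true  _   _  le _  = contradiction (le (- (+ 1))) λ ()
exponents-forced false false false false _   _  _  _  = refl , refl
exponents-forced true  false true  true  _   _  _  le = contradiction (le (- (+ 1))) λ ()
exponents-forced true  false true  false _   _  _  _  = refl , refl
exponents-forced true  false false true  _   _  _  le = contradiction (le (- (+ 1))) λ ()
exponents-forced true  false false false _   _  _  le = contradiction (le (- (+ 1))) λ ()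
exponents-forced false true  true  true  _   _  _  le = contradiction (le (+ 1)) λ ()
exponents-forced false true  true  false _   _  _  le = contradiction (le (+ 1)) λ ()
exponents-forced false true  false true  _   _  _  _  = refl , refl
exponents-forced false true  false false _   _  _  le = contradiction (le (+ 1)) λ ()

-- On a single pair (1 , 1) every letter but `ρ₃` is idle, so stopping means that `ρ₃` has occurred.
pair-run : ∀ V → ¬ Active (runₗ V (⟨ 1 , 1 , 1 ⟩ ∷ [])) → runₗ V (⟨ 1 , 1 , 1 ⟩ ∷ []) ≡ []
pair-run []       ¬a = contradiction tt ¬a
pair-run (ρ₁ ∷ V) ¬a = pair-run V ¬a
pair-run (ρ₂ ∷ V) ¬a = pair-run V ¬a
pair-run (ρ₃ ∷ V) ¬a = runₗ-inactive V λ ()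
pair-run (ρ₄ ∷ V) ¬a = pair-run V ¬a
pair-run (ρ₅ ∷ V) ¬a = pair-run V ¬a

-- Reading off the first factor from tests

module FirstFactor
  (Ω T′ : Word) (j : Letter₄₅) (k : ℕ) (a b : Bool) (ab≢ : (a , b) ≢ (true , true))
  -- Conditional on stability, so as to cover both `ρⱼᵏ`, for which it holds outright, and `ρⱼ*`,
  -- which agrees with `ρⱼᵏ` once `k` letters have brought it to rest.
  (Ω-value : ∀ σ → act (letter j) (run (repeated k j) σ) ≡ run (repeated k j) σ →
             ⟦ Ω ⟧ σ (run (repeated k j) σ))
  where

  T : Word
  T = (Ω · closingWord a b) · T′

  -- Since `ys` is inactive, so is the sequence left by the first factor. The unknown `T′` then does
  -- nothing, and the value of `T` is explicit.
  outcome : ∀ {L n p m us} σ → terms σ ≡ ⟨ n , suc p , suc m ⟩ ∷ us → Passes T L σ →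
            ⟦ Ω ⟧ σ (run (repeated k j) σ) → ∀ {ys} → tailRun (repeated k j) us ≡ ys → ¬ Active ys →
            cancel n (cap a p) (cap b m) ys ≤ᶜ runₗ L (terms σ)
  outcome {L} {n} {p} {m} {us} σ eq t s {ys} eq′ ¬a z =
    subst (λ ts → countTerms z ts ≤ countTerms z (runₗ L (terms σ))) value
      (above t τ (τ , (x , s , closingWord-run a b x) ,
        fixed-inactive T′ (subst (¬_ ∘ Active) (sym value) (cancel-inactive n (cap a p) (cap b m) ¬a))) z)
    where
    x = run (repeated k j) σ
    τ = run (closing a b) x
    value : terms τ ≡ cancel n (cap a p) (cap b m) ys
    value rewrite terms-run (closing a b) x | terms-run (repeated k j) σ | eq
                | run-letters {n = n} {p} {m} (repeated-letters k j) us | eq′ =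
      closing-active a b n p m ys

  Ω-fixed : ∀ σ {n p m us ys} → terms σ ≡ ⟨ n , suc p , suc m ⟩ ∷ us →
            tailRun (repeated k j) us ≡ ys → tailAct (letter j) ys ≡ ys → ⟦ Ω ⟧ σ (run (repeated k j) σ)
  Ω-fixed σ {n} {p} {m} {us} eq eq′ eq″ = Ω-value σ (𝒮-≡ stays)
    where
    stays : actTerms (letter j) (terms (run (repeated k j) σ)) ≡ terms (run (repeated k j) σ)
    stays rewrite terms-run (repeated k j) σ | eq
                | run-letters {n = n} {p} {m} (repeated-letters k j) us | eq′ =
      trans (act-letter j _) (cong (_ ∷_) eq″)

  -- Only `k ≤ c` is asked, since a finite word may imitate `ρⱼ*` by any large enough power. The
  -- converse bound for a finite power takes a further test.
  record Matches (L : List Letter) : Set where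
    constructor matches
    field
      {U V}  : List Letter
      split  : L ≡ U ++ ρ₃ ∷ V
      before : All (_≢ ρ₃) U
      has₁≡a : has₁ U ≡ a
      has₂≡b : has₂ U ≡ b
      c      : ℕ
      tail   : ∀ ts → tailRun U ts ≡ tailRun (repeated c j) ts
      k≤c    : k ≤ c

    run-active : ∀ n p m ts → runₗ L (⟨ n , suc p , suc m ⟩ ∷ ts) ≡
                 runₗ V (cancel n (cap a p) (cap b m) (tailRun (repeated c j) ts))
    run-active n p m ts rewrite split | sym has₁≡a | sym has₂≡b | sym (tail ts) =
      run-to-ρ₃ U V before n p m ts

  lonesThen : ℕ → 𝒮 → 𝒮
  lonesThen i σ = push₁₁ (pushLones (replicate i j) σ)

  -- (1 , 1) forces a `ρ₃`; the next three fix the exponents of `ρ₁` and `ρ₂`; the fifth excludes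
  -- `letter (other j)` before `ρ₃`. The last family gives `k ≤ c`: for `c = i < k`, `T` reduces the
  -- final (1 , 1) to one term and stops there, whereas `L` makes it the first pair, and can then
  -- stop only by deleting it. All `i < k` are listed because `c` is not known in advance.
  Tests : List Letter → Set
  Tests L = Passes T L (push₁₁ ∅) × Passes T L (push 2 1 (s≤s z≤n) ∅) ×
            Passes T L (push 1 2 (s≤s z≤n) ∅) × Passes T L (push 2 2 (s≤s z≤n) ∅) ×
            Passes T L (push₁₁ (pushLone (other j) ∅)) ×
            (∀ {i} → i < k → Passes T L (lonesThen i (push₁₁ ∅)))

  tests⇒matches : ∀ L → Tests L → Matches L
  tests⇒matches L (t₁₁ , t₂₁ , t₁₂ , t₂₂ , tₒ , tᵢ) with split-ρ₃ L
  ... | inj₁ q = contradiction (subst Active (sym (run-before-ρ₃ L q 1 0 0 [])) tt) (stopped t₁₁)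
  ... | inj₂ (U , V , refl , q) = conclude (power-tail-or-eats j U)
    where
    forced : ∀ p m σ → terms σ ≡ ⟨ 1 , suc p , suc m ⟩ ∷ [] → Passes T L σ →
             cancel 1 (cap a p) (cap b m) [] ≤ᶜ cancel 1 (cap (has₁ U) p) (cap (has₂ U) m) []
    forced p m σ eq t z = ≤-trans
      (outcome σ eq t (Ω-fixed σ eq (tailRun-[] (repeated k j)) (tailRun-[] (letter j ∷ [])))
        (tailRun-[] (repeated k j)) (λ ()) z)
      (≤-reflexive (cong (countTerms z) (trans (cong (runₗ L) eq) (trans (run-to-ρ₃ U V q 1 p m [])
        (trans (cong (runₗ V ∘ cancel 1 (cap (has₁ U) p) (cap (has₂ U) m)) (tailRun-[] U))
          (runₗ-inactive V (cancel-inactive 1 (cap (has₁ U) p) (cap (has₂ U) m) λ ())))))))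

    run-11 : ∀ n us → runₗ L (⟨ n , 1 , 1 ⟩ ∷ us) ≡ runₗ V (tailRun U us)
    run-11 n us = trans (run-to-ρ₃ U V q n 0 0 us)
      (cong (runₗ V) (cancel-11 (has₁ U) (has₂ U) n (tailRun U us)))

    refute : ∀ {n us} σ → terms σ ≡ ⟨ n , 1 , 1 ⟩ ∷ us → Passes T L σ →
             tailRun (repeated k j) us ≡ lone (other j) 1 ∷ [] → runₗ V (tailRun U us) ≡ [] → ⊥
    refute {n} {us} σ eq t eq′ eq″ = lone-≰ (other j) λ z → subst₂ (λ xs ys → countTerms z xs ≤ countTerms z ys)
      (cancel-11 a b n _) (trans (cong (runₗ L) eq) (trans (run-11 n us) eq″))
      (outcome σ eq t (Ω-fixed σ eq eq′ (tailAct-lone-other j [])) eq′ (lone-inactive (other j) []) z)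

    conclude : _ → Matches L
    conclude (inj₂ eats) = ⊥-elim (refute _ refl tₒ
      (tailRun-fixed k (letter j) (tailAct-lone-other j []))
      (trans (cong (runₗ V) (eats 1)) (runₗ-inactive V λ ())))
    conclude (inj₁ (c , tail)) = matches refl q
      (proj₁ exponents) (proj₂ exponents) c tail (≮⇒≥ λ c<k → refute _ refl (tᵢ c<k)
        (left c<k) (right c<k))
      where
      exponents = exponents-forced a b (has₁ U) (has₂ U) ab≢
        (forced 1 0 _ refl t₂₁) (forced 0 1 _ refl t₁₂) (forced 1 1 _ refl t₂₂)
      us : List Term
      us = terms (pushLones (replicate c j) (push₁₁ ∅))
      left : c < k → tailRun (repeated k j) us ≡ lone (other j) 1 ∷ []
      left c<k with d , refl ← m≤n⇒∃[o]m+o≡n c<k =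
        trans (cong (λ i → tailRun (repeated i j) us) (sym (+-suc c d)))
          (trans (tailRun-lones c (suc d) j (push₁₁ ∅)) (tailRun-pair d j))
      tail-us : tailRun U us ≡ ⟨ 1 , 1 , 1 ⟩ ∷ []
      tail-us = trans (tail us) (trans (cong (λ i → tailRun (repeated i j) us) (sym (+-identityʳ c)))
        (tailRun-lones c 0 j (push₁₁ ∅)))
      right : c < k → runₗ V (tailRun U us) ≡ []
      right c<k = trans (cong (runₗ V) tail-us) (pair-run V
        (subst (¬_ ∘ Active) (trans (run-11 _ us) (cong (runₗ V) tail-us)) (stopped (tᵢ c<k))))

  testable-matches : Testable T Matches
  testable-matches = testable-map tests⇒matches
    (test _ and test _ and test _ and test _ and test _ and tests-below k _)

-- Passing a factor that is not the last

module FinitePower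
  (Ω T′ : Word) (j : Letter₄₅) (k : ℕ) (a b : Bool) (ab≢ : (a , b) ≢ (true , true))
  (Ω-value : ∀ σ → ⟦ Ω ⟧ σ (run (repeated k j) σ))
  where

  open FirstFactor Ω T′ j k a b ab≢ (λ σ _ → Ω-value σ)

  factorRun : List Term → List Term
  factorRun ts = runₗ (closing a b) (runₗ (repeated k j) ts)

  tailRun-lones-all : ∀ σ → tailRun (repeated k j) (terms (pushLones (replicate k j) σ)) ≡ terms σ
  tailRun-lones-all σ = trans
    (cong (λ i → tailRun (repeated i j) (terms (pushLones (replicate k j) σ))) (sym (+-identityʳ k)))
    (tailRun-lones k 0 j σ)

  factorRun-active : ∀ n p m ts → factorRun (⟨ n , suc p , suc m ⟩ ∷ ts) ≡
                     cancel n (cap a p) (cap b m) (tailRun (repeated k j) ts)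
  factorRun-active n p m ts =
    trans (cong (runₗ (closing a b)) (run-letters (repeated-letters k j) ts)) (closing-active a b n p m _)

  factorRun-inactive : ∀ {ts} → ¬ Active ts → factorRun ts ≡ ts
  factorRun-inactive ¬a =
    trans (cong (runₗ (closing a b)) (runₗ-inactive (repeated k j) ¬a)) (runₗ-inactive (closing a b) ¬a)

  factorRun-lonesThen : ∀ σ → factorRun (terms (lonesThen k σ)) ≡ terms σ
  factorRun-lonesThen σ = trans (factorRun-active _ 0 0 _) (trans (cancel-11 a b _ _) (tailRun-lones-all σ))

  factorValue : 𝒮 → 𝒮
  factorValue σ = run (closing a b) (run (repeated k j) σ)

  factor-run : ∀ σ → ⟦ Ω · closingWord a b ⟧ σ (factorValue σ)
  factor-run σ = run (repeated k j) σ , Ω-value σ , closingWord-run a b (run (repeated k j) σ)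

  terms-factorValue : ∀ σ → terms (factorValue σ) ≡ factorRun (terms σ)
  terms-factorValue σ = trans (terms-run (closing a b) (run (repeated k j) σ))
    (cong (runₗ (closing a b)) (terms-run (repeated k j) σ))

  Shift : (List Letter → Set) → List Letter → Set
  Shift P L = ∃ λ V → (∀ ts → runₗ L ts ≡ runₗ V (factorRun ts)) × P V

  -- `lonesThen k` is a right inverse of the first factor, so tests for `T′` pull back to tests for
  -- `T` and are passed by the remainder `V` of `L`. The additional test, with one term more than
  -- `k`, gives `c ≤ k`: a higher power would eat it too.
  testable-shift : ∀ {P} → Testable T′ P → Testable T (Shift P)
  testable-shift {P} t = testable-map conclude
    (testable-matches and test (lonesThen k (pushLone j ∅)) and
      all-tests)
    where
    all-tests : Testable T (λ L → All (λ τ → Passes T L (lonesThen k τ)) (tests t))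
    all-tests = testable (map (lonesThen k) (tests t)) λ L ps → map⁻ {P = Passes T L} {f = lonesThen k} ps
    conclude : ∀ L → Matches L × Passes T L (lonesThen k (pushLone j ∅)) ×
               All (λ τ → Passes T L (lonesThen k τ)) (tests t) → Shift P L
    conclude L (M , p , ps) = V , runs , sound t V (All.map (λ {τ} → pull {τ}) ps)
      where
      open Matches M
      us : List Term
      us = terms (pushLones (replicate k j) (pushLone j ∅))
      all-eaten : k < c → tailRun (repeated c j) us ≡ []
      all-eaten k<c with d , eq ← m≤n⇒∃[o]m+o≡n k<c =
        trans (cong (λ i → tailRun (repeated i j) us) (trans (sym eq) (sym (+-suc k d))))
          (trans (tailRun-lones k (suc d) j (pushLone j ∅))
            (trans (cong (tailRun (repeated d j)) (tailAct-lone j [])) (tailRun-[] (repeated d j))))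
      c≤k : c ≤ k
      c≤k = ≮⇒≥ λ k<c → lone-≰ j λ z → subst₂ (λ xs ys → countTerms z xs ≤ countTerms z ys)
        (cancel-11 a b _ _)
        (trans (run-active _ 0 0 us) (trans (cong (runₗ V) (trans (cancel-11 a b _ _) (all-eaten k<c)))
          (runₗ-inactive V λ ())))
        (outcome (lonesThen k (pushLone j ∅)) refl p (Ω-value _) (tailRun-lones-all (pushLone j ∅))
          (lone-inactive j []) z)
      runs : ∀ ts → runₗ L ts ≡ runₗ V (factorRun ts)
      runs ts with activity ts
      ... | isInactive ¬a = trans (runₗ-inactive L ¬a)
        (sym (trans (cong (runₗ V) (factorRun-inactive ¬a)) (runₗ-inactive V ¬a)))
      ... | isActive n p m xs = trans (run-active n p m xs) (cong (runₗ V)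
        (trans (cong (λ i → cancel n (cap a p) (cap b m) (tailRun (repeated i j) xs)) (≤-antisym c≤k k≤c))
          (sym (factorRun-active n p m xs))))
      pull : ∀ {τ} → Passes T L (lonesThen k τ) → Passes T′ V τ
      pull {τ} q = passes (subst (¬_ ∘ Active) e (stopped q)) λ τ′ s →
        subst (terms τ′ ≤ᶜ_) e (above q τ′ (τ , fires , s))
        where
        e : runₗ L (terms (lonesThen k τ)) ≡ runₗ V (terms τ)
        e = trans (runs _) (cong (runₗ V) (factorRun-lonesThen τ))
        fires : ⟦ Ω · closingWord a b ⟧ (lonesThen k τ) τ
        fires = subst (⟦ Ω · closingWord a b ⟧ (lonesThen k τ))
          (𝒮-≡ {factorValue (lonesThen k τ)} {τ}
            (trans (terms-factorValue (lonesThen k τ)) (factorRun-lonesThen τ)))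
          (factor-run (lonesThen k τ))

  factorRun-shrinks : ∀ {ts} → Active ts → size (factorRun ts) < size ts
  factorRun-shrinks {ts} act with activity ts
  ... | isInactive ¬a      = contradiction act ¬a
  ... | isActive n p m us rewrite factorRun-active n p m us =
    s≤s (≤-trans (size-mono smaller)
      (+-monoˡ-≤ (size us) (≤-trans (n≤1+n (suc (p + m))) (≤-reflexive (cong suc (sym (+-suc p m)))))))
    where
    cap-≤ : ∀ c q → cap c q ≤ q
    cap-≤ true  q = z≤n
    cap-≤ false q = ≤-refl
    smaller : cancel n (cap a p) (cap b m) (tailRun (repeated k j) us) ⊆ ⟨ n , p , m ⟩ ∷ us
    smaller = ∷₀-⊆ (≤-trans (m∸n≤m (cap a p) (cap a p ⊓ cap b m)) (cap-≤ a p))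
                   (≤-trans (m∸n≤m (cap b m) (cap a p ⊓ cap b m)) (cap-≤ b m)) (tailRun-⊆ (repeated k j) us)

-- The last factor, with an infinite power of one letter

strip : Letter₄₅ → List Term → List Term
strip j    []                       = []
strip four (⟨ _ , _ , zero  ⟩ ∷ ts) = strip four ts
strip four (⟨ n , _ , suc m ⟩ ∷ ts) = ⟨ n , 0 , suc m ⟩ ∷ ts
strip five (⟨ _ , zero  , _ ⟩ ∷ ts) = strip five ts
strip five (⟨ n , suc p , _ ⟩ ∷ ts) = ⟨ n , suc p , 0 ⟩ ∷ ts

-- Each letter either deletes a pair or meets one containing the other sign, which it turns into a
-- pair it fixes. Hence `length ts` letters reach the value of `ρⱼ*`.
tailRun-strip : ∀ j ts {c} → length ts ≤ c → tailRun (repeated c j) ts ≡ strip j ts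
tailRun-strip j    []                       {c} _     = tailRun-[] (repeated c j)
tailRun-strip four (⟨ _ , _ , zero  ⟩ ∷ ts) (s≤s le) = tailRun-strip four ts le
tailRun-strip four (⟨ _ , _ , suc _ ⟩ ∷ ts) {suc c} _ = tailRun-fixed c ρ₄ refl
tailRun-strip five (⟨ _ , zero  , _ ⟩ ∷ ts) (s≤s le) = tailRun-strip five ts le
tailRun-strip five (⟨ _ , suc _ , _ ⟩ ∷ ts) {suc c} _ = tailRun-fixed c ρ₅ refl

strip-inactive : ∀ j ts → ¬ Active (strip j ts)
strip-inactive four (⟨ _ , _ , zero  ⟩ ∷ ts) = strip-inactive four ts
strip-inactive five (⟨ _ , zero  , _ ⟩ ∷ ts) = strip-inactive five ts
strip-inactive four (⟨ _ , _ , suc _ ⟩ ∷ ts) ()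
strip-inactive five (⟨ _ , suc _ , _ ⟩ ∷ ts) ()

strip-fixed : ∀ j ts → tailAct (letter j) (strip j ts) ≡ strip j ts
strip-fixed four []                       = refl
strip-fixed five []                       = refl
strip-fixed four (⟨ _ , _ , zero  ⟩ ∷ ts) = strip-fixed four ts
strip-fixed five (⟨ _ , zero  , _ ⟩ ∷ ts) = strip-fixed five ts
strip-fixed four (⟨ _ , _ , suc _ ⟩ ∷ ts) = refl
strip-fixed five (⟨ _ , suc _ , _ ⟩ ∷ ts) = refl

module LastFactor (j : Letter₄₅) (a b : Bool) (ab≢ : (a , b) ≢ (true , true)) where

  Ω : Word
  -- The trailing `ε` is the end of the fold in `word₄₅` on a list of one block.
  Ω = [ letter j ] * · ε

  lastRun : List Term → List Term
  lastRun ts = runₗ (closing a b) (runₗ (repeated (length ts) j) ts)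

  lastRun-active : ∀ n p m us → lastRun (⟨ n , suc p , suc m ⟩ ∷ us) ≡
                   cancel n (cap a p) (cap b m) (strip j us)
  lastRun-active n p m us = trans
    (cong (runₗ (closing a b)) (run-letters {n = n} {p} {m} (repeated-letters (suc (length us)) j) us))
    (trans (closing-active a b n p m (tailRun (repeated (suc (length us)) j) us)) (cong (cancel n (cap a p) (cap b m))
      (tailRun-strip j us (n≤1+n (length us)))))

  lastRun-inactive : ∀ {ts} → ¬ Active ts → lastRun ts ≡ ts
  lastRun-inactive {ts} ¬a =
    trans (cong (runₗ (closing a b)) (runₗ-inactive (repeated (length ts) j) ¬a)) (runₗ-inactive (closing a b) ¬a)

  lastRun-stops : ∀ ts → ¬ Active (lastRun ts)
  lastRun-stops ts with activity ts
  ... | isInactive ¬a     = subst (¬_ ∘ Active) (sym (lastRun-inactive ¬a)) ¬a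
  ... | isActive n p m us = subst (¬_ ∘ Active) (sym (lastRun-active n p m us))
    (cancel-inactive n (cap a p) (cap b m) (strip-inactive j us))

  stable : ∀ ts → actTerms (letter j) (runₗ (repeated (length ts) j) ts) ≡ runₗ (repeated (length ts) j) ts
  stable ts with activity ts
  ... | isInactive ¬a rewrite runₗ-inactive (repeated (length ts) j) ¬a = actTerms-inactive (letter j) ¬a
  ... | isActive n p m us
    rewrite run-letters {n = n} {p} {m} (repeated-letters (suc (length us)) j) us
          | tailRun-strip j us (n≤1+n (length us)) =
    trans (act-letter j _) (cong (_ ∷_) (strip-fixed j us))

  last-value : ∀ {σ τ} → ⟦ Ω · closingWord a b ⟧ σ τ → terms τ ≡ lastRun (terms σ)
  last-value {σ} {τ} s = trans
    (cong terms (functional (Ω · closingWord a b) {σ} {τ} s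
      (x , (x , star-run k (letter j) (𝒮-≡ fixed-terms) , refl) , closingWord-run a b x)))
    (trans (terms-run (closing a b) x) (cong (runₗ (closing a b)) (terms-run (repeated k j) σ)))
    where
    k = length (terms σ)
    x = run (repeated k j) σ
    fixed-terms : actTerms (letter j) (terms x) ≡ terms x
    fixed-terms rewrite terms-run (repeated k j) σ = stable (terms σ)

  -- Taking `k` to be the length of `σ` makes `ρⱼᶜ` with `c ≥ k` indistinguishable from `ρⱼ*` at
  -- `σ`. The result is inactive, so the remainder `V` cannot change it. `ε` takes the place of the
  -- missing `T′`.
  testable-last : ∀ σ → Testable (Ω · closingWord a b)
    (λ L → ∀ τ → ⟦ Ω · closingWord a b ⟧ σ τ → runₗ L (terms σ) ≡ terms τ)
  testable-last σ = testable-⊇ (λ { (_ , s , refl) → s }) (testable-map conclude testable-matches)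
    where
    open FirstFactor Ω ε j (length (terms σ)) a b ab≢
      (λ _ eq → _ , star-run (length (terms σ)) (letter j) eq , refl)
    conclude : ∀ L → Matches L → ∀ τ → ⟦ Ω · closingWord a b ⟧ σ τ → runₗ L (terms σ) ≡ terms τ
    conclude L M τ s = trans (runs (terms σ) ≤-refl) (sym (last-value {σ} {τ} s))
      where
      open Matches M
      runs : ∀ ts → length ts ≤ length (terms σ) → runₗ L ts ≡ lastRun ts
      runs ts le with activity ts
      ... | isInactive ¬a = trans (runₗ-inactive L ¬a) (sym (lastRun-inactive ¬a))
      ... | isActive n p m us = trans (run-active n p m us) (trans
        (cong (λ xs → runₗ V (cancel n (cap a p) (cap b m) xs))
          (tailRun-strip j us (≤-trans (n≤1+n _) (≤-trans le k≤c))))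
        (trans (runₗ-inactive V (cancel-inactive n (cap a p) (cap b m) (strip-inactive j us)))
          (sym (lastRun-active n p m us))))

-- Assembling the factors of a form

pure-value : ∀ ω → Pure ω → ¬ Final ω → ∃₂ λ j k → ∀ σ → ⟦ word₄₅ ω ⟧ σ (run (repeated k j) σ)
pure-value (blocks [] _)                _ _ = four , 0 , λ _ → refl
pure-value (blocks ((j , 1+ k) ∷ []) _) _ _ =
  j , suc k , λ σ → _ , power-run (suc k) (letter j) σ , refl
pure-value (blocks ((j , ∗) ∷ []) _)    _ ¬final = contradiction refl ¬final
pure-value (blocks (_ ∷ _ ∷ _) (i≢j ∷ _)) (inj₁ (refl ∷ refl ∷ _)) _ = contradiction refl i≢j
pure-value (blocks (_ ∷ _ ∷ _) (i≢j ∷ _)) (inj₂ (refl ∷ refl ∷ _)) _ = contradiction refl i≢j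
pure-value ⟨ρ₄ρ₅⟩* (inj₁ ()) _
pure-value ⟨ρ₄ρ₅⟩* (inj₂ ()) _

pure-final : ∀ ω → Pure ω → Final ω → ∃ λ j → word₄₅ ω ≡ [ letter j ] * · ε
pure-final (blocks ((j , _) ∷ []) _) _ refl = j , refl
pure-final (blocks (_ ∷ _ ∷ _) (i≢j ∷ _)) (inj₁ (refl ∷ refl ∷ _)) _ = contradiction refl i≢j
pure-final (blocks (_ ∷ _ ∷ _) (i≢j ∷ _)) (inj₂ (refl ∷ refl ∷ _)) _ = contradiction refl i≢j
pure-final ⟨ρ₄ρ₅⟩* (inj₁ ()) _
pure-final ⟨ρ₄ρ₅⟩* (inj₂ ()) _

active? : ∀ ts → Dec (Active ts)
active? ts with activity ts
... | isActive _ _ _ _ = yes tt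
... | isInactive ¬a    = no ¬a

Determined : Word → 𝒮 → Set
Determined T σ = Testable T (λ L → ∀ τ → ⟦ T ⟧ σ τ → runₗ L (terms σ) ≡ terms τ)

Stops : Word → 𝒮 → Set
Stops T σ = ∀ τ → ⟦ T ⟧ σ τ → ¬ Active (terms τ)

inactive-determined : ∀ T {σ} → ¬ Active (terms σ) → Determined T σ × Stops T σ
inactive-determined T {σ} ¬a =
  testable [] (λ L _ τ s → trans (runₗ-inactive L ¬a) (stays τ s)) ,
  λ τ s → subst (¬_ ∘ Active) (stays τ s) ¬a
  where
  stays : ∀ τ → ⟦ T ⟧ σ τ → terms σ ≡ terms τ
  stays τ s = cong terms (functional T (fixed-inactive T {σ} ¬a) s)

good-step : ∀ Tᵢ → Good Tᵢ → ¬ Final (ω Tᵢ) → ∀ σ → ∃ λ σ₁ → ⟦ factorWord Tᵢ ⟧ σ σ₁ ×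
            (Active (terms σ) → size (terms σ₁) < size (terms σ)) ×
            (∀ T′ → Determined T′ σ₁ × Stops T′ σ₁ →
             Determined (factorWord Tᵢ · T′) σ × Stops (factorWord Tᵢ · T′) σ)
good-step Tᵢ@(factor ω a b) (p , ab≢) ¬final σ with pure-value ω p ¬final
... | j , k , value = σ₁ , s₁ , shrinks , λ T′ (d , stops) →
    testable-map (λ L (V , runs , h) τ s → trans (runs (terms σ))
      (trans (cong (runₗ V) (sym eq₁)) (h τ (rest T′ s)))) (F.testable-shift T′ d) ,
    λ τ s → stops τ (rest T′ s)
  where
  module F T′ = FinitePower (word₄₅ ω) T′ j k a b ab≢ value
  -- The value of the factor does not depend on what follows; `ε` is a placeholder for `T′`.
  σ₁ = F.factorValue ε σ
  s₁ : ⟦ factorWord Tᵢ ⟧ σ σ₁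
  s₁ = F.factor-run ε σ
  eq₁ : terms σ₁ ≡ F.factorRun ε (terms σ)
  eq₁ = F.terms-factorValue ε σ
  shrinks : Active (terms σ) → size (terms σ₁) < size (terms σ)
  shrinks act rewrite eq₁ = F.factorRun-shrinks ε act
  rest : ∀ T′ {τ} → ⟦ factorWord Tᵢ · T′ ⟧ σ τ → ⟦ T′ ⟧ σ₁ τ
  rest T′ (_ , s , t) with refl ← functional (factorWord Tᵢ) s s₁ = t

determined-cons : ∀ w {σ σ₁} → ⟦ w 0 ⟧ σ σ₁ →
  Determined (w 0 · ∞ (w ≫ 1)) σ × Stops (w 0 · ∞ (w ≫ 1)) σ → Determined (∞ w) σ × Stops (∞ w) σ
determined-cons w {σ} {σ₁} s₁ (d , stops) =
  testable-map (λ L h τ s → h τ (uncons s))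
    (testable-⊇ {w 0 · ∞ (w ≫ 1)} {∞ w} (λ (_ , s , t) → ∞-cons w s t) d) ,
  λ τ s → stops τ (uncons s)
  where
  uncons : ∀ {τ} → ⟦ ∞ w ⟧ σ τ → ⟦ w 0 · ∞ (w ≫ 1) ⟧ σ τ
  uncons s = σ₁ , s₁ , ∞-uncons w s s₁

-- Each factor strictly shrinks an active sequence, so only finitely many factors are unfolded
-- before it stops, after which no tests are needed. This keeps the list of tests finite for an
-- infinite product.
determined-∞ : ∀ k (Ts : ℕ → Factor) → (∀ i → Good (Ts i)) → (∀ i → ¬ Final (ω (Ts i))) →
  ∀ σ → size (terms σ) < k → Determined (∞ (factorWord ∘ Ts)) σ × Stops (∞ (factorWord ∘ Ts)) σ
determined-∞ (suc k) Ts good nf σ le = by-activity (active? (terms σ))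
  where
  by-activity : Dec (Active (terms σ)) →
    Determined (∞ (factorWord ∘ Ts)) σ × Stops (∞ (factorWord ∘ Ts)) σ
  by-activity (no ¬a) = inactive-determined (∞ (factorWord ∘ Ts)) ¬a
  by-activity (yes act) =
    let σ₁ , s₁ , shrinks , step = good-step (Ts 0) (good 0) (nf 0) σ in
    determined-cons (factorWord ∘ Ts) s₁ (step (∞ (factorWord ∘ Ts ≫ 1))
      (determined-∞ k (λ i → Ts (i + 1)) (λ i → good (i + 1)) (λ i → nf (i + 1)) σ₁
        (≤-trans (shrinks act) (s≤s⁻¹ le))))

determined-finite : ∀ Ts last → All Good Ts → Good last → All (λ T → ¬ Final (ω T)) Ts →
  Final (ω last) → ∀ σ → Determined (formWord Ts last) σ × Stops (formWord Ts last) σ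
determined-finite [] (factor ω a b) [] (p , ab≢) [] final σ with pure-final ω p final
... | j , eq rewrite eq = testable-last σ ,
    λ τ s → subst (¬_ ∘ Active) (sym (last-value {σ} {τ} s)) (lastRun-stops (terms σ))
  where
  open LastFactor j a b ab≢
determined-finite (T ∷ Ts) last (g ∷ gs) g′ (nf ∷ nfs) final σ =
  let σ₁ , _ , _ , step = good-step T g nf σ in
  step (formWord Ts last) (determined-finite Ts last gs g′ nfs final σ₁)

determined : ∀ T → EveryFactor Good T → ∀ σ → Determined (word T) σ × Stops (word T) σ
determined (infinite Ts nf)            good       σ = determined-∞ _ Ts good nf σ ≤-refl
determined (finite Ts nfs last final) (gs , good) σ = determined-finite Ts last gs good nfs final σ

good⇒maximal : ∀ T → EveryFactor Good T → MaximalInR T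
good⇒maximal T good =
  (λ σ τ s τ∈𝒮₀ → proj₂ (determined T good σ) τ s (𝒮₀⇒Active τ τ∈𝒮₀)) ,
  testable⇒maximal (word T) (λ σ → proj₁ (determined T good σ))

theorem37 : ∀ (T : Form) →
    MaximalInR T ⇔
    (MaximalInR₁₂₃ T ⊎
    EveryFactor (λ Tᵢ → (ω Tᵢ ∈ℒ four ⊎ ω Tᵢ ∈ℒ five) × (a Tᵢ , b Tᵢ) ≢ (true , true)) T)
theorem37 T = mk⇔ (inj₂ ∘ maximal⇒good T) λ where
  (inj₁ max)  → good⇒maximal T (maximal₁₂₃⇒good T max)
  (inj₂ good) → good⇒maximal T good
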